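{- Let $(W,S)$ be a Coxeter system with $|S|<\infty$ and let $\varphi$ be a group automorphism of $W$ with $\varphi^2=\mathrm{id}$ and $\varphi(S)=S$. Let $G=\{\mathrm{id},\varphi\}$, $W^G$ the fixed point subgroup, and $(\widetilde W,\widetilde S)$, $\phi:\widetilde W\to W$ as in the context. Then the subposet of the Bruhat order $\mathrm{Br}(W)$ induced by $W^G$ is isomorphic to the Bruhat order $\mathrm{Br}(\widetilde W)$.
   Context: Bruhat order on a Coxeter group: $v\le w$ iff some reduced expression of $w$ contains a subexpression that is a reduced expression of $v$. For $J\subseteq S$ with $W_J=\langle J\rangle$ finite, $w_0(J)$ is the longest element of $W_J$. Let $\widetilde S=\{\widetilde s_J\mid J\subseteq S\text{ is a }G\text{ -orbit and }W_J\text{ finite}\}$. By a known theorem (H\'ee, M\"uhlherr, Steinberg), with suitable Coxeter relations $\widetilde S$ generates a Coxeter system $(\widetilde W,\widetilde S)$ such that $\widetilde s_J\mapsto w_0(J)$ defines an injective group homomorphism $\phi:\widetilde W\to W$ with image $W^G$; in particular $W^G\cong\widetilde W$. -}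

module Defs where

open import Data.Nat using (ℕ; _≤_)
open import Data.Fin using (Fin)
open import Data.List using (List; []; _∷_; [_]; _++_; concat; replicate; length)
open import Data.List.Relation.Unary.All using (All)
open import Data.List.Relation.Binary.Sublist.Propositional using (_⊆_)
open import Data.Product using (Σ; ∃; ∃-syntax; _×_)
open import Data.Sum using (_⊎_)
open import Relation.Binary.PropositionalEquality using (_≡_; _≢_)
open import Function.Bundles using (_⇔_)

-- A Coxeter matrix on the finite generating set S = Fin n.
-- Convention: the entry 0 encodes m(s,t) = ∞.
CoxMat : ℕ → Set
CoxMat n = Fin n → Fin n → ℕ

IsCoxeterMatrix : ∀ {n} → CoxMat n → Set
IsCoxeterMatrix {n} m =
  (∀ (s : Fin n) → m s s ≡ 1) ×
  (∀ (s t : Fin n) → m s t ≡ m t s) ×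
  (∀ (s t : Fin n) → s ≢ t → m s t ≢ 1)

-- The Coxeter group W = ⟨ S | (st)^{m(s,t)} = 1 for m(s,t) < ∞ ⟩,
-- realised as words in S modulo the congruence generated by the relations
-- (a setoid; elements of W are equivalence classes of words).
data Equiv {n} (m : CoxMat n) : List (Fin n) → List (Fin n) → Set where
  rel   : ∀ s t → m s t ≢ 0 →
          Equiv m (concat (replicate (m s t) (s ∷ t ∷ []))) []
  ctx   : ∀ u v x y → Equiv m x y → Equiv m (u ++ x ++ v) (u ++ y ++ v)
  ≈refl  : ∀ x → Equiv m x x
  ≈sym   : ∀ {x y} → Equiv m x y → Equiv m y x
  ≈trans : ∀ {x y z} → Equiv m x y → Equiv m y z → Equiv m x z

Reduced : ∀ {n} → CoxMat n → List (Fin n) → Set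
Reduced m w = ∀ v → Equiv m v w → length w ≤ length v

HasLength : ∀ {n} → CoxMat n → List (Fin n) → ℕ → Set
HasLength m w l = ∃[ w' ] (Equiv m w' w × Reduced m w' × length w' ≡ l)

Bruhat : ∀ {n} → CoxMat n → List (Fin n) → List (Fin n) → Set
Bruhat m v w =
  ∃[ w' ] ∃[ v' ] (Equiv m w' w × Reduced m w' × v' ⊆ w' ×
                   Reduced m v' × Equiv m v' v)

record IsInvolutiveSAut {n} (m : CoxMat n) (φ : List (Fin n) → List (Fin n)) : Set where
  field
    resp  : ∀ u v → Equiv m u v → Equiv m (φ u) (φ v)
    hom   : ∀ u v → Equiv m (φ (u ++ v)) (φ u ++ φ v)
    invol : ∀ w → Equiv m (φ (φ w)) w
    gen   : ∀ s → ∃[ t ] Equiv m (φ [ s ]) [ t ]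
    -- (φ(S) ⊆ S; together with φ² = id this gives φ(S) = S)

Fixed : ∀ {n} → CoxMat n → (List (Fin n) → List (Fin n)) → List (Fin n) → Set
Fixed m φ w = Equiv m (φ w) w

InOrb : ∀ {n} → CoxMat n → (List (Fin n) → List (Fin n)) → Fin n → Fin n → Set
InOrb m φ s t = t ≡ s ⊎ Equiv m (φ [ s ]) [ t ]

SameOrb : ∀ {n} → CoxMat n → (List (Fin n) → List (Fin n)) → Fin n → Fin n → Set
SameOrb m φ s s' = ∀ t → InOrb m φ s t ⇔ InOrb m φ s' t

-- W_J is finite, J the orbit of s: there is N such that every element
-- of W_J (word in the letters of J) equals a word in J of length ≤ N
-- (equivalently, W_J has finitely many elements since S is finite).
FiniteParabolic : ∀ {n} → CoxMat n → (List (Fin n) → List (Fin n)) → Fin n → Set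
FiniteParabolic m φ s =
  ∃[ N ] (∀ w → All (InOrb m φ s) w →
            ∃[ w' ] (All (InOrb m φ s) w' × Equiv m w' w × length w' ≤ N))

IsLongestIn : ∀ {n} → CoxMat n → (List (Fin n) → List (Fin n)) → Fin n → List (Fin n) → Set
IsLongestIn m φ s x =
  (∃[ x' ] (All (InOrb m φ s) x' × Equiv m x' x)) ×
  (∀ v → All (InOrb m φ s) v → ∀ a b → HasLength m v a → HasLength m x b → a ≤ b)

-- The data (W̃, S̃) and ϕ : W̃ → W of the Hée–Mühlherr–Steinberg theorem:
-- a Coxeter system on S̃ = Fin k, with S̃ in bijection (via the orbit
-- representative rep) with the G-orbits J with W_J finite, and an injective
-- homomorphism ψ with ψ(s̃_J) = w₀(J) and image W^G.
record FoldedSystem {n} (m : CoxMat n) (φ : List (Fin n) → List (Fin n)) : Set where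
  field
    k      : ℕ
    m̃      : CoxMat k
    m̃-cox  : IsCoxeterMatrix m̃
    ψ      : List (Fin k) → List (Fin n)
    ψ-resp : ∀ u v → Equiv m̃ u v → Equiv m (ψ u) (ψ v)
    ψ-hom  : ∀ u v → Equiv m (ψ (u ++ v)) (ψ u ++ ψ v)
    ψ-inj  : ∀ u v → Equiv m (ψ u) (ψ v) → Equiv m̃ u v
    ψ-fix  : ∀ u → Fixed m φ (ψ u)
    ψ-onto : ∀ w → Fixed m φ w → ∃[ u ] Equiv m (ψ u) w
    rep       : Fin k → Fin n
    rep-fin   : ∀ i → FiniteParabolic m φ (rep i)
    rep-w0    : ∀ i → IsLongestIn m φ (rep i) (ψ [ i ])
    rep-inj   : ∀ i j → SameOrb m φ (rep i) (rep j) → i ≡ j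
    rep-surj  : ∀ s → FiniteParabolic m φ s → ∃[ i ] SameOrb m φ s (rep i)

record BruhatIso {n k} (m : CoxMat n) (φ : List (Fin n) → List (Fin n)) (m̃ : CoxMat k) : Set where
  field
    F      : List (Fin k) → List (Fin n)
    G      : List (Fin n) → List (Fin k)
    F-resp : ∀ u v → Equiv m̃ u v → Equiv m (F u) (F v)
    F-fix  : ∀ u → Fixed m φ (F u)
    G-resp : ∀ w w' → Fixed m φ w → Equiv m w w' → Equiv m̃ (G w) (G w')
    GF     : ∀ u → Equiv m̃ (G (F u)) u
    FG     : ∀ w → Fixed m φ w → Equiv m (F (G w)) w
    order  : ∀ u v → Bruhat m̃ u v ⇔ Bruhat m (F u) (F v)

{-# OPTIONS --safe #-}
module Submission where

-- The presentation only bounds the order of `st` from above, so a representation is needed to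
-- separate short alternating words. The classical one has the real weights 2 cos (π/m). The path
-- with m - 1 vertices has the adjacency eigenvalues 2 cos (kπ/m), 0 < k < m, so its adjacency
-- operator on integer functions can replace the weight, and no real numbers enter. The relation
-- (st)^m = 1 then becomes a statement about the discrete wave equation on the path with zero
-- boundary values: a wave has period 2m, and over a period its values at times of one parity sum to
-- zero. Since φ² = id, an orbit J has at most two letters, so W_J has order 2 or is dihedral. If it
-- is finite, its only nontrivial element fixed by φ is w₀(J). This is why a single exchanged letter
-- in W drags a whole block with it and yields an exchange in W̃.

-- A letter s of a reduced word of W̃ becomes the block ω s = w₀(J), an alternating word in the orbit J.
-- An element of W fixed by φ has both letters of J as left descents or neither, so either w₀(J)
-- splits off with additive length or it can be put in front with additive length. Together with
-- the exchange property this shows that reduced words of W̃ become reduced words of W, and, by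
-- peeling off blocks with the lifting property, that a fixed element below such a word of W is
-- already given by a subword of blocks.
--
-- The inverse isomorphism must recognise the fixed elements among all words, so the word problem of W
-- has to be decided constructively. The exchange property comes from the parity of the number of
-- occurrences of a reflection, up to double negation; the fact that m s t is the exact order of st
-- comes from a numbers game; both together decide equality of reduced words by induction on length.

open import Defs
open import Algebra.Bundles using (Group)
import Algebra.Properties.AbelianGroup
import Algebra.Properties.CommutativeSemigroup
import Algebra.Properties.Group as GroupProperties
open import Data.Bool using (Bool; true; false; not; _xor_) renaming (_≟_ to _≟ᵇ_)
open import Data.Bool.Properties using (xor-same; not-distribˡ-xor)
open import Data.Empty using (⊥; ⊥-elim)
open import Data.Fin using (Fin) renaming (_≟_ to _≟ᶠ_)
open import Data.Integer using (ℤ; _+_; _*_; -_; 0ℤ; 1ℤ) renaming (+_ to pos)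
import Data.Integer.Properties as ℤₚ
open import Data.Integer.Tactic.RingSolver using (solve-∀)
open import Data.List using (List; []; _∷_; [_]; _++_; concat; concatMap; replicate; length; map; applyUpTo)
open import Data.List.Properties
  using (++-assoc; ++-identityʳ; length-++; length-map; map-++; map-∘; map-id; map-applyUpTo; ∷-injective)
open import Data.List.Relation.Binary.Pointwise as Pw using (Pointwise; []; _∷_)
open import Data.List.Relation.Binary.Sublist.Propositional using (_⊆_; []; _∷_; _∷ʳ_; ⊆-refl; ⊆-trans; minimum)
import Data.List.Relation.Binary.Sublist.Propositional.Properties as Subₚ
open import Data.List.Relation.Unary.All as All using (All; []; _∷_)
import Data.List.Relation.Unary.All.Properties as Allₚ
open import Data.List.Relation.Unary.Any using (Any; here; there)
import Data.List.Relation.Unary.Any.Properties as Anyₚ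
open import Data.Nat using (ℕ; zero; suc; z≤n; s≤s; _∸_)
  renaming (_+_ to _+ⁿ_; _≤_ to _≤ⁿ_; _<_ to _<ⁿ_; _≟_ to _≟ⁿ_; _≤?_ to _≤?ⁿ_)
open import Data.Nat.Induction using (<-rec)
import Data.Nat.Properties as ℕₚ
open import Data.Product using (∃-syntax; _×_; _,_; proj₁; proj₂)
open import Data.Sum using (_⊎_; inj₁; inj₂)
open import Function using (case_of_)
open import Function.Bundles using (mk⇔)
open import Relation.Binary.PropositionalEquality
  using (_≡_; _≢_; refl; sym; trans; cong; cong₂; subst; subst₂; module ≡-Reasoning)
import Relation.Binary.Reasoning.Setoid as SetoidReasoning
open import Relation.Nullary using (Dec; yes; no; ¬_)
open import Relation.Nullary.Decidable using (decidable-stable; map′; ¬¬-excluded-middle)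

open Algebra.Properties.AbelianGroup ℤₚ.+-0-abelianGroup
  using () renaming (∙-cancelˡ to ℤ-cancelˡ; ∙-cancelʳ to ℤ-cancelʳ)
open Algebra.Properties.CommutativeSemigroup ℤₚ.+-commutativeSemigroup using (interchange)
open Algebra.Properties.CommutativeSemigroup ℕₚ.+-commutativeSemigroup using (x∙yz≈y∙xz)

-- The discrete wave equation

-- g j y is the value at time j and position y; the boundary conditions are those of Dirichlet.
record IsWave (M : ℕ) (g : ℕ → ℕ → ℤ) : Set where
  field
    left  : ∀ j → g j 0 ≡ 0ℤ
    right : ∀ j → g j M ≡ 0ℤ
    step  : ∀ j y → suc (suc y) ≤ⁿ M →
            g (suc (suc j)) (suc y) + g j (suc y) ≡ g (suc j) y + g (suc j) (suc (suc y))

glue : ∀ a b c d x y → a + x ≡ c + y → y + b ≡ d + x → a + b ≡ c + d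
glue a b c d x y p q = ℤ-cancelʳ (x + y) (a + b) (c + d) (begin
  a + b + (x + y)    ≡⟨ reorder₁ a b x y ⟩
  (a + x) + (y + b)  ≡⟨ cong₂ _+_ p q ⟩
  (c + y) + (d + x)  ≡⟨ reorder₂ c y d x ⟩
  c + d + (x + y)    ∎)
  where
  open ≡-Reasoning
  reorder₁ : ∀ a b x y → a + b + (x + y) ≡ (a + x) + (y + b)
  reorder₁ = solve-∀
  reorder₂ : ∀ c y d x → (c + y) + (d + x) ≡ c + d + (x + y)
  reorder₂ = solve-∀

suc*x≡0⇒x≡0 : ∀ x n → pos (suc n) * x ≡ 0ℤ → x ≡ 0ℤ
suc*x≡0⇒x≡0 x n eq with ℤₚ.i*j≡0⇒i≡0∨j≡0 (pos (suc n)) eq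
... | inj₁ ()
... | inj₂ p = p

module Wave {M : ℕ} {g : ℕ → ℕ → ℤ} (isWave : IsWave M g) where
  open IsWave isWave
  open ≡-Reasoning

  private
    parallelogram₁ : ∀ q j l → suc (q +ⁿ l) ≤ⁿ M →
      g (suc q +ⁿ j) (suc l) + g j (q +ⁿ l) ≡ g (suc j) (suc (q +ⁿ l)) + g (q +ⁿ j) l
    parallelogram₁ zero j l _ = refl
    parallelogram₁ (suc q) j l le = trans
      (glue (g (suc (suc (q +ⁿ j))) (suc l)) (g j (suc (q +ⁿ l)))
            (g (suc (q +ⁿ j)) l) (g (suc j) (suc (suc (q +ⁿ l))))
            (g (q +ⁿ j) (suc l)) (g (suc (q +ⁿ j)) (suc (suc l)))
            (step (q +ⁿ j) l (ℕₚ.≤-trans (s≤s (s≤s (ℕₚ.m≤n+m l q))) le))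
            (subst (λ z → g (suc (q +ⁿ j)) (suc (suc l)) + g j z ≡ g (suc j) (suc z) + g (q +ⁿ j) (suc l))
              (ℕₚ.+-suc q l)
              (parallelogram₁ q j (suc l) (subst (λ z → suc z ≤ⁿ M) (sym (ℕₚ.+-suc q l)) le))))
      (ℤₚ.+-comm (g (suc (q +ⁿ j)) l) (g (suc j) (suc (suc (q +ⁿ l)))))

  -- Discrete d'Alembert principle: the four points are the corners of a rectangle with sides along
  -- the characteristics (p, p) and (q, -q), and opposite corners have equal sums. The rectangle is
  -- assembled from unit cells, each an instance of `step`; `glue` cancels the two values on a
  -- shared side.
  parallelogram : ∀ p q j l → p +ⁿ (q +ⁿ l) ≤ⁿ M →
    g (p +ⁿ (q +ⁿ j)) (p +ⁿ l) + g j (q +ⁿ l) ≡ g (p +ⁿ j) (p +ⁿ (q +ⁿ l)) + g (q +ⁿ j) l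
  parallelogram zero q j l _ = ℤₚ.+-comm (g (q +ⁿ j) l) (g j (q +ⁿ l))
  parallelogram (suc p) q j l le =
    glue (g (suc (p +ⁿ (q +ⁿ j))) (suc (p +ⁿ l))) (g j (q +ⁿ l))
         (g (suc (p +ⁿ j)) (suc (p +ⁿ (q +ⁿ l)))) (g (q +ⁿ j) l)
         (g (p +ⁿ j) (p +ⁿ (q +ⁿ l))) (g (p +ⁿ (q +ⁿ j)) (p +ⁿ l))
         ih₁
         (trans (parallelogram p q j l (ℕₚ.≤-trans (ℕₚ.n≤1+n _) le))
                (ℤₚ.+-comm (g (p +ⁿ j) (p +ⁿ (q +ⁿ l))) (g (q +ⁿ j) l)))
    where
    ih₁ : g (suc (p +ⁿ (q +ⁿ j))) (suc (p +ⁿ l)) + g (p +ⁿ j) (p +ⁿ (q +ⁿ l)) ≡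
          g (suc (p +ⁿ j)) (suc (p +ⁿ (q +ⁿ l))) + g (p +ⁿ (q +ⁿ j)) (p +ⁿ l)
    ih₁ = subst₂ (λ a b → g (suc a) (suc (p +ⁿ l)) + g (p +ⁿ j) b ≡ g (suc (p +ⁿ j)) (suc b) + g a (p +ⁿ l))
            (x∙yz≈y∙xz q p j) (x∙yz≈y∙xz q p l)
            (parallelogram₁ q (p +ⁿ j) (p +ⁿ l) (subst (λ z → suc z ≤ⁿ M) (x∙yz≈y∙xz p q l) le))

  -- Two corners of the rectangle lie on the boundary, so after `M` steps a wave returns mirrored
  -- and negated. Two such returns give `periodic`.
  reflect : ∀ p y j → p +ⁿ y ≡ M → g (p +ⁿ (y +ⁿ j)) p + g j y ≡ 0ℤ
  reflect p y j eq = begin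
    g (p +ⁿ (y +ⁿ j)) p + g j y ≡⟨ cong₂ (λ a b → g (p +ⁿ (y +ⁿ j)) a + g j b) (sym (ℕₚ.+-identityʳ p)) (sym (ℕₚ.+-identityʳ y)) ⟩
    g (p +ⁿ (y +ⁿ j)) (p +ⁿ 0) + g j (y +ⁿ 0) ≡⟨ parallelogram p y j 0 (ℕₚ.≤-reflexive (trans (cong (p +ⁿ_) (ℕₚ.+-identityʳ y)) eq)) ⟩
    g (p +ⁿ j) (p +ⁿ (y +ⁿ 0)) + g (y +ⁿ j) 0 ≡⟨ cong₂ _+_ (trans (cong (g (p +ⁿ j)) (trans (cong (p +ⁿ_) (ℕₚ.+-identityʳ y)) eq)) (right _)) (left _) ⟩
    0ℤ ∎

  periodic : ∀ j y → y ≤ⁿ M → g (M +ⁿ (M +ⁿ j)) y ≡ g j y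
  periodic j y le = ℤ-cancelʳ (g (M +ⁿ j) (M ∸ y)) _ _ (trans h₂ (trans (sym h₁) (ℤₚ.+-comm (g (M +ⁿ j) (M ∸ y)) (g j y))))
    where
    h₁ : g (M +ⁿ j) (M ∸ y) + g j y ≡ 0ℤ
    h₁ = subst (λ t → g t (M ∸ y) + g j y ≡ 0ℤ)
           (trans (sym (ℕₚ.+-assoc (M ∸ y) y j)) (cong (_+ⁿ j) (ℕₚ.m∸n+n≡m le)))
           (reflect (M ∸ y) y j (ℕₚ.m∸n+n≡m le))
    h₂ : g (M +ⁿ (M +ⁿ j)) y + g (M +ⁿ j) (M ∸ y) ≡ 0ℤ
    h₂ = subst (λ t → g t y + g (M +ⁿ j) (M ∸ y) ≡ 0ℤ)
           (trans (sym (ℕₚ.+-assoc y (M ∸ y) (M +ⁿ j))) (cong (_+ⁿ (M +ⁿ j)) (ℕₚ.m+[n∸m]≡n le)))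
           (reflect y (M ∸ y) (M +ⁿ j) (ℕₚ.m+[n∸m]≡n le))

  -- A solution of time period 2 vanishes: by the parallelogram rule it grows linearly along a diagonal.
  module _ (1≤M : 1 ≤ⁿ M) (period₂ : ∀ j y → y ≤ⁿ M → g (suc (suc j)) y ≡ g j y) where
    private
      diagonal : ∀ p j → p ≤ⁿ M → g (suc (p +ⁿ j)) p ≡ pos p * g j 1
      diagonal zero j _ = trans (left _) (sym (ℤₚ.*-zeroˡ (g j 1)))
      diagonal (suc p) j le = begin
        g (suc (suc (p +ⁿ j))) (suc p)   ≡⟨ period₂ (p +ⁿ j) (suc p) le ⟩
        g (p +ⁿ j) (suc p)               ≡⟨ sym (ℤₚ.+-identityʳ _) ⟩
        g (p +ⁿ j) (suc p) + 0ℤ          ≡⟨ cong₂ _+_ (cong (g (p +ⁿ j)) (sym (trans (ℕₚ.+-suc p 0) (cong suc (ℕₚ.+-identityʳ p))))) (sym (left (suc j))) ⟩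
        g (p +ⁿ j) (p +ⁿ 1) + g (suc j) 0 ≡⟨ sym (parallelogram p 1 j 0 (subst (_≤ⁿ M) (sym (trans (ℕₚ.+-suc p 0) (cong suc (ℕₚ.+-identityʳ p)))) le)) ⟩
        g (p +ⁿ suc j) (p +ⁿ 0) + g j 1  ≡⟨ cong (λ z → z + g j 1) (cong₂ g (ℕₚ.+-suc p j) (ℕₚ.+-identityʳ p)) ⟩
        g (suc (p +ⁿ j)) p + g j 1       ≡⟨ cong (λ z → z + g j 1) (diagonal p j (ℕₚ.≤-trans (ℕₚ.n≤1+n p) le)) ⟩
        pos p * g j 1 + g j 1              ≡⟨ lin (pos p) (g j 1) ⟩
        (1ℤ + pos p) * g j 1              ∎
        where
        lin : ∀ p x → p * x + x ≡ (1ℤ + p) * x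
        lin = solve-∀

      first≡0 : ∀ j → g j 1 ≡ 0ℤ
      first≡0 j = nz M refl 1≤M
        where
        nz : ∀ M′ → M′ ≡ M → 1 ≤ⁿ M′ → g j 1 ≡ 0ℤ
        -- On the right boundary `diagonal` reads `0 = M * g j 1`, and `M` is positive.
        nz (suc k) refl _ = suc*x≡0⇒x≡0 _ k (trans (sym (diagonal M j ℕₚ.≤-refl)) (right _))

      shifted≡0 : ∀ p j → p ≤ⁿ M → g (p +ⁿ j) p ≡ 0ℤ
      shifted≡0 p j le = trans (sym (period₂ (p +ⁿ j) p le))
        (trans (cong (λ t → g t p) (cong suc (sym (ℕₚ.+-suc p j))))
          (trans (diagonal p (suc j) le) (trans (cong (λ z → pos p * z) (first≡0 (suc j))) (ℤₚ.*-zeroʳ (pos p)))))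

    period₂⇒zero : ∀ j y → y ≤ⁿ M → g j y ≡ 0ℤ
    -- By periodicity the time may be advanced by `2y`, which puts the point on a diagonal that
    -- starts at the left boundary.
    period₂⇒zero j y le = trans (sym (even y)) (trans (cong (λ t → g t y) (ℕₚ.+-assoc y y j)) (shifted≡0 y (y +ⁿ j) le))
      where
      even : ∀ p → g (p +ⁿ p +ⁿ j) y ≡ g j y
      even zero = refl
      even (suc p) = trans (cong (λ t → g (suc (t +ⁿ j)) y) (ℕₚ.+-suc p p)) (trans (period₂ _ y le) (even p))

-- The step is 2 because in the game `s` is fired at even and `t` at odd times: a third letter
-- collects the values of each parity separately.
Σ₂ : ℕ → ℕ → (ℕ → ℤ) → ℤ
Σ₂ zero j f = 0ℤ
Σ₂ (suc k) j f = f j + Σ₂ k (suc (suc j)) f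

Σ₂-cong : ∀ k j {f f′} → (∀ i → f i ≡ f′ i) → Σ₂ k j f ≡ Σ₂ k j f′
Σ₂-cong zero j h = refl
Σ₂-cong (suc k) j h = cong₂ _+_ (h j) (Σ₂-cong k _ h)

Σ₂-+ : ∀ k j f f′ → Σ₂ k j f + Σ₂ k j f′ ≡ Σ₂ k j (λ i → f i + f′ i)
Σ₂-+ zero j f f′ = refl
Σ₂-+ (suc k) j f f′ = trans (interchange (f j) _ (f′ j) _) (cong (λ z → f j + f′ j + z) (Σ₂-+ k _ f f′))

Σ₂-zero : ∀ k j {f} → (∀ i → f i ≡ 0ℤ) → Σ₂ k j f ≡ 0ℤ
Σ₂-zero zero j h = refl
Σ₂-zero (suc k) j h = cong₂ _+_ (h j) (Σ₂-zero k _ h)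

Σ₂-shift : ∀ k j f → f (k +ⁿ (k +ⁿ j)) ≡ f j → Σ₂ k (suc (suc j)) f ≡ Σ₂ k j f
Σ₂-shift k j f h = ℤ-cancelˡ (f j) _ _
  (trans (last k j f) (trans (cong (λ z → Σ₂ k j f + z) h) (ℤₚ.+-comm _ (f j))))
  where
  last : ∀ k j f → Σ₂ (suc k) j f ≡ Σ₂ k j f + f (k +ⁿ (k +ⁿ j))
  last zero j f = ℤₚ.+-comm (f j) 0ℤ
  last (suc k) j f = begin
    f j + Σ₂ (suc k) (suc (suc j)) f ≡⟨ cong (λ z → f j + z) (last k (suc (suc j)) f) ⟩
    f j + (Σ₂ k (suc (suc j)) f + f (k +ⁿ (k +ⁿ suc (suc j)))) ≡⟨ sym (ℤₚ.+-assoc (f j) _ _) ⟩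
    f j + Σ₂ k (suc (suc j)) f + f (k +ⁿ (k +ⁿ suc (suc j))) ≡⟨ cong (λ t → f j + Σ₂ k (suc (suc j)) f + f t) (idx k j) ⟩
    f j + Σ₂ k (suc (suc j)) f + f (suc k +ⁿ (suc k +ⁿ j)) ∎
    where
    open ≡-Reasoning
    idx : ∀ k j → k +ⁿ (k +ⁿ suc (suc j)) ≡ suc k +ⁿ (suc k +ⁿ j)
    idx k j rewrite ℕₚ.+-suc k (suc j) | ℕₚ.+-suc k j | ℕₚ.+-suc k (suc (k +ⁿ j)) = refl

Σ₂-suc : ∀ k j f → Σ₂ k (suc j) f ≡ Σ₂ k j (λ i → f (suc i))
Σ₂-suc zero j f = refl
Σ₂-suc (suc k) j f = cong (λ z → f (suc j) + z) (Σ₂-suc k _ f)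

Σ₂-suc² : ∀ k j f → Σ₂ k (2 +ⁿ j) f ≡ Σ₂ k j (λ i → f (2 +ⁿ i))
Σ₂-suc² k j f = trans (Σ₂-suc k (suc j) f) (Σ₂-suc k j (λ i → f (suc i)))

module _ {M : ℕ} {g : ℕ → ℕ → ℤ} (1≤M : 1 ≤ⁿ M) (isWave : IsWave M g) where
  open IsWave isWave
  open Wave isWave

  sum-isWave : IsWave M (λ j y → Σ₂ M j (λ i → g i y))
  sum-isWave = record
    { left  = λ j → Σ₂-zero M j left
    ; right = λ j → Σ₂-zero M j right
    ; step  = λ j y le → begin
        Σ₂ M (2 +ⁿ j) (λ i → g i (suc y)) + Σ₂ M j (λ i → g i (suc y))
          ≡⟨ cong (λ z → z + Σ₂ M j (λ i → g i (suc y))) (Σ₂-suc² M j (λ i → g i (suc y))) ⟩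
        Σ₂ M j (λ i → g (2 +ⁿ i) (suc y)) + Σ₂ M j (λ i → g i (suc y))
          ≡⟨ Σ₂-+ M j _ _ ⟩
        Σ₂ M j (λ i → g (2 +ⁿ i) (suc y) + g i (suc y))
          ≡⟨ Σ₂-cong M j (λ i → step i y le) ⟩
        Σ₂ M j (λ i → g (suc i) y + g (suc i) (2 +ⁿ y))
          ≡⟨ sym (Σ₂-+ M j _ _) ⟩
        Σ₂ M j (λ i → g (suc i) y) + Σ₂ M j (λ i → g (suc i) (2 +ⁿ y))
          ≡⟨ sym (cong₂ _+_ (Σ₂-suc M j (λ i → g i y)) (Σ₂-suc M j (λ i → g i (2 +ⁿ y)))) ⟩
        Σ₂ M (suc j) (λ i → g i y) + Σ₂ M (suc j) (λ i → g i (2 +ⁿ y)) ∎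
    }
    where open ≡-Reasoning

  -- Summation over a full period yields a wave again. Advancing its time by 2 trades one summand
  -- for another that equals it by periodicity, so it has time period 2 and vanishes.
  sum≡0 : ∀ j y → y ≤ⁿ M → Σ₂ M j (λ i → g i y) ≡ 0ℤ
  sum≡0 = Wave.period₂⇒zero sum-isWave 1≤M
    (λ j y le → Σ₂-shift M j (λ i → g i y) (periodic j y le))

-- The numbers game and the order of st

-- Comparison with the entries of a Coxeter matrix, where 0 stands for ∞.
infix 4 _<∞_ _≤∞_
_<∞_ _≤∞_ : ℕ → ℕ → Set
k <∞ M = k <ⁿ M ⊎ M ≡ 0
k ≤∞ M = k ≤ⁿ M ⊎ M ≡ 0

<∞-pred : ∀ {k M} → suc k <∞ M → k <∞ M
<∞-pred (inj₁ le) = inj₁ (ℕₚ.≤-trans (ℕₚ.n≤1+n _) le)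
<∞-pred (inj₂ z) = inj₂ z

≤∞-pred : ∀ {k M} → suc k ≤∞ M → k ≤∞ M
≤∞-pred (inj₁ le) = inj₁ (ℕₚ.≤-trans (ℕₚ.n≤1+n _) le)
≤∞-pred (inj₂ z) = inj₂ z

next : ℕ → ℕ → ℕ
next M r with suc (suc r) ≟ⁿ M
... | yes _ = 0
... | no  _ = suc r

-- The vertices of ℕ are cut into consecutive paths with M − 1 vertices (a single infinite path when M = 0);
-- rank M x is the position of x in its path.
rank : ℕ → ℕ → ℕ
rank M zero = 0
rank M (suc x) = next M (rank M x)

guard : ℕ → ℤ → ℤ
guard zero v = 0ℤ
guard (suc _) v = v

-- An edge joins `x` to `suc x` unless `suc x` starts a new path. The operators of all entries `M`
-- must act on one space of functions, which is why ℕ is cut into infinitely many paths instead of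
-- keeping a single path for each `M`. For `M = 2` the paths are single vertices and the operator is
-- zero, as 2 cos (π/2) is.
below above nbr : ℕ → (ℕ → ℤ) → ℕ → ℤ
below M f zero = 0ℤ
below M f (suc x) = guard (rank M (suc x)) (f x)
above M f x = guard (rank M (suc x)) (f (suc x))
nbr M f x = below M f x + above M f x

guard-+ : ∀ r a b → guard r (a + b) ≡ guard r a + guard r b
guard-+ zero a b = refl
guard-+ (suc r) a b = refl

guard-0 : ∀ r → guard r 0ℤ ≡ 0ℤ
guard-0 zero = refl
guard-0 (suc r) = refl

nbr-cong : ∀ M {f g : ℕ → ℤ} → (∀ x → f x ≡ g x) → ∀ x → nbr M f x ≡ nbr M g x
nbr-cong M h zero = cong (λ z → 0ℤ + guard (rank M 1) z) (h 1)
nbr-cong M h (suc x) = cong₂ (λ y z → guard (rank M (suc x)) y + guard (rank M (suc (suc x))) z) (h x) (h (suc (suc x)))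

nbr-+ : ∀ M f g x → nbr M (λ y → f y + g y) x ≡ nbr M f x + nbr M g x
nbr-+ M f g zero = trans (cong (λ z → 0ℤ + z) (guard-+ (rank M 1) (f 1) (g 1))) (interchange 0ℤ 0ℤ (guard (rank M 1) (f 1)) (guard (rank M 1) (g 1)))
nbr-+ M f g (suc x) = trans
  (cong₂ _+_ (guard-+ (rank M (suc x)) (f x) (g x)) (guard-+ (rank M (suc (suc x))) (f (suc (suc x))) (g (suc (suc x)))))
  (interchange (guard (rank M (suc x)) (f x)) _ (guard (rank M (suc (suc x))) (f (suc (suc x)))) _)

nbr-0 : ∀ M x → nbr M (λ _ → 0ℤ) x ≡ 0ℤ
nbr-0 M zero = cong (λ z → 0ℤ + z) (guard-0 (rank M 1))
nbr-0 M (suc x) = cong₂ _+_ (guard-0 (rank M (suc x))) (guard-0 (rank M (suc (suc x))))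

nbr-neg : ∀ M f x → nbr M f x + nbr M (λ y → - f y) x ≡ 0ℤ
nbr-neg M f x = trans (sym (nbr-+ M f (λ y → - f y) x)) (trans (nbr-cong M (λ y → ℤₚ.+-inverseʳ (f y)) x) (nbr-0 M x))

next-no : ∀ M r → suc (suc r) ≢ M → next M r ≡ suc r
next-no M r ne with suc (suc r) ≟ⁿ M
... | yes e = ⊥-elim (ne e)
... | no _ = refl

next-yes : ∀ M r → suc (suc r) ≡ M → next M r ≡ 0
next-yes M r e with suc (suc r) ≟ⁿ M
... | yes _ = refl
... | no ne = ⊥-elim (ne e)

next-< : ∀ M r → suc (suc r) ≤ⁿ M → suc (suc (next M r)) ≤ⁿ M
next-< M r le with suc (suc r) ≟ⁿ M
... | yes e = ℕₚ.≤-trans (s≤s (s≤s z≤n)) le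
... | no ne = ℕₚ.≤∧≢⇒< le ne

rank-< : ∀ M x → 2 ≤ⁿ M → suc (suc (rank M x)) ≤ⁿ M
rank-< M zero le = le
rank-< M (suc x) le = next-< M (rank M x) (rank-< M x le)

rank-block : ∀ M b y → rank M b ≡ 0 → suc (suc y) ≤ⁿ M ⊎ M ≡ 0 → rank M (y +ⁿ b) ≡ y
rank-block M b zero e _ = e
rank-block M b (suc y) e h = trans (cong (next M) (rank-block M b y e (weaken h))) (next-no M y (ne h))
  where
  weaken : suc (suc (suc y)) ≤ⁿ M ⊎ M ≡ 0 → suc (suc y) ≤ⁿ M ⊎ M ≡ 0
  weaken (inj₁ le) = inj₁ (ℕₚ.≤-trans (ℕₚ.n≤1+n _) le)
  weaken (inj₂ z) = inj₂ z
  ne : suc (suc (suc y)) ≤ⁿ M ⊎ M ≡ 0 → suc (suc y) ≢ M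
  ne (inj₁ le) refl = ℕₚ.<-irrefl refl le
  ne (inj₂ ()) refl

block-start : ∀ M x → ∃[ b ] (rank M b ≡ 0 × x ≡ rank M x +ⁿ b)
block-start M zero = 0 , refl , refl
block-start M (suc x) with suc (suc (rank M x)) ≟ⁿ M
... | yes e = suc x , next-yes M (rank M x) e , refl
... | no ne = proj₁ ih , proj₁ (proj₂ ih) , cong suc (proj₂ (proj₂ ih))
  where ih = block-start M x

module Recurrence (M : ℕ) (2≤M : 2 ≤ⁿ M) (a : ℕ → ℕ → ℤ)
  (rec : ∀ j x → a (suc (suc j)) x ≡ - a j x + nbr M (a (suc j)) x) where

  module Block (b : ℕ) (b₀ : rank M b ≡ 0) where
    -- Position `suc y` stands for the vertex `y + b`. The shift by one makes room for the boundary
    -- positions 0 and `M` around the `M − 1` vertices of the path.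
    g : ℕ → ℕ → ℤ
    g j zero = 0ℤ
    g j (suc y) with suc y ≟ⁿ M
    ... | yes _ = 0ℤ
    ... | no _ = a j (y +ⁿ b)

    g-in : ∀ j y → suc y ≢ M → g j (suc y) ≡ a j (y +ⁿ b)
    g-in j y ne with suc y ≟ⁿ M
    ... | yes e = ⊥-elim (ne e)
    ... | no _ = refl

    g-right : ∀ j M′ → M′ ≡ M → g j M′ ≡ 0ℤ
    g-right j zero e = refl
    g-right j (suc M′) e with suc M′ ≟ⁿ M
    ... | yes _ = refl
    ... | no ne = ⊥-elim (ne e)

    lower : ∀ j y → suc (suc y) ≤ⁿ M → below M (a j) (y +ⁿ b) ≡ g j y
    lower j zero le = at-start b b₀
      where
      at-start : ∀ b → rank M b ≡ 0 → below M (a j) b ≡ 0ℤ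
      at-start zero _ = refl
      at-start (suc b) e = cong (λ r → guard r (a j b)) e
    lower j (suc y) le = trans (cong (λ r → guard r (a j (y +ⁿ b))) (rank-block M b (suc y) b₀ (inj₁ le)))
      (sym (g-in j y (λ { refl → ℕₚ.<-irrefl refl (ℕₚ.≤-trans (ℕₚ.n≤1+n _) le) })))

    upper : ∀ j y → suc (suc y) ≤ⁿ M → above M (a j) (y +ⁿ b) ≡ g j (suc (suc y))
    upper j y le = trans (cong (λ r → guard (next M r) (a j (suc y +ⁿ b))) (rank-block M b y b₀ (inj₁ le))) end
      where
      end : guard (next M y) (a j (suc y +ⁿ b)) ≡ g j (suc (suc y))
      end with suc (suc y) ≟ⁿ M
      ... | yes _ = refl
      ... | no _ = refl

    isWave : IsWave M g
    isWave = record
      { left = λ _ → refl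
      ; right = λ j → g-right j M refl
      ; step = λ j y le → let ne = λ { refl → ℕₚ.<-irrefl refl le } in
          begin
            g (suc (suc j)) (suc y) + g j (suc y)
              ≡⟨ cong₂ _+_ (g-in (suc (suc j)) y ne) (g-in j y ne) ⟩
            a (suc (suc j)) (y +ⁿ b) + a j (y +ⁿ b)
              ≡⟨ cong (λ z → z + a j (y +ⁿ b)) (rec j (y +ⁿ b)) ⟩
            - a j (y +ⁿ b) + nbr M (a (suc j)) (y +ⁿ b) + a j (y +ⁿ b)
              ≡⟨ cancel (a j (y +ⁿ b)) (nbr M (a (suc j)) (y +ⁿ b)) ⟩
            nbr M (a (suc j)) (y +ⁿ b)
              ≡⟨ cong₂ _+_ (lower (suc j) y le) (upper (suc j) y le) ⟩
            g (suc j) y + g (suc j) (suc (suc y)) ∎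
      }
      where
      open ≡-Reasoning
      cancel : ∀ x y → - x + y + x ≡ y
      cancel = solve-∀

  1≤M : 1 ≤ⁿ M
  1≤M = ℕₚ.≤-trans (s≤s z≤n) 2≤M

  transfer : (P : (ℕ → ℤ) → Set) → (∀ b b₀ y → y ≤ⁿ M → P (λ i → Block.g b b₀ i y)) →
             (∀ {f g} → (∀ i → f i ≡ g i) → P f → P g) → ∀ x → P (λ i → a i x)
  transfer P h resp x with block-start M x
  ... | b , b₀ , e = resp (λ i → trans (Block.g-in b b₀ i (rank M x) ne) (cong (a i) (sym e)))
                          (h b b₀ (suc (rank M x)) (ℕₚ.≤-trans (ℕₚ.n≤1+n _) (rank-< M x 2≤M)))
    where
    ne : suc (rank M x) ≢ M
    ne e′ = ℕₚ.<-irrefl e′ (rank-< M x 2≤M)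

  periodic : ∀ j x → a (M +ⁿ (M +ⁿ j)) x ≡ a j x
  periodic j = transfer (λ f → f (M +ⁿ (M +ⁿ j)) ≡ f j)
    (λ b b₀ y → Wave.periodic (Block.isWave b b₀) j y)
    (λ h p → trans (sym (h _)) (trans p (h _)))

  sum-zero : ∀ j x → Σ₂ M j (λ i → a i x) ≡ 0ℤ
  sum-zero j = transfer (λ f → Σ₂ M j f ≡ 0ℤ)
    (λ b b₀ y → sum≡0 1≤M (Block.isWave b b₀) j y)
    (λ h p → trans (sym (Σ₂-cong M j h)) p)

nbr-Σ₂ : ∀ M k j (a : ℕ → ℕ → ℤ) x → nbr M (λ y → Σ₂ k j (λ i → a i y)) x ≡ Σ₂ k j (λ i → nbr M (a i) x)
nbr-Σ₂ M zero j a x = nbr-0 M x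
nbr-Σ₂ M (suc k) j a x = trans (nbr-+ M (a j) _ x) (cong (λ z → nbr M (a j) x + z) (nbr-Σ₂ M k _ a x))

alt : ∀ {n} → ℕ → Fin n → Fin n → List (Fin n)
alt zero s t = []
alt (suc k) s t = s ∷ alt k t s

pow : ∀ {n} → ℕ → Fin n → Fin n → List (Fin n)
pow k s t = concat (replicate k (s ∷ t ∷ []))

-- Mozes' numbers game, with the numbers replaced by integer functions on ℕ and the
-- weight 2 cos (π / m s t) of an edge by the adjacency operator of the paths with m s t − 1 vertices.
module NumbersGame {n : ℕ} (m : CoxMat n) (cox : IsCoxeterMatrix m) where

  State : Set
  State = Fin n → ℕ → ℤ

  infix 4 _≐_
  _≐_ : State → State → Set
  p ≐ q = ∀ u x → p u x ≡ q u x

  fire : Fin n → State → State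
  fire s p u with u ≟ᶠ s
  ... | yes _ = λ x → - p s x
  ... | no  _ = λ x → p u x + nbr (m s u) (p s) x

  fire-self : ∀ s p x → fire s p s x ≡ - p s x
  fire-self s p x with s ≟ᶠ s
  ... | yes _ = refl
  ... | no ne = ⊥-elim (ne refl)

  fire-other : ∀ s p u x → u ≢ s → fire s p u x ≡ p u x + nbr (m s u) (p s) x
  fire-other s p u x ne with u ≟ᶠ s
  ... | yes e = ⊥-elim (ne e)
  ... | no _ = refl

  fire-cong : ∀ s {p q} → p ≐ q → fire s p ≐ fire s q
  fire-cong s h u x with u ≟ᶠ s
  ... | yes _ = cong -_ (h s x)
  ... | no _ = cong₂ _+_ (h u x) (nbr-cong (m s u) (h s) x)

  play : List (Fin n) → State → State
  play [] p = p
  play (s ∷ w) p = play w (fire s p)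

  play-cong : ∀ w {p q} → p ≐ q → play w p ≐ play w q
  play-cong [] h = h
  play-cong (s ∷ w) h = play-cong w (fire-cong s h)

  play-++ : ∀ u v p → play (u ++ v) p ≡ play v (play u p)
  play-++ [] v p = refl
  play-++ (s ∷ u) v p = play-++ u v (fire s p)

  play-square : ∀ s p → fire s (fire s p) ≐ p
  play-square s p u x with u ≟ᶠ s
  ... | yes refl = trans (cong -_ (fire-self s p x)) (ℤₚ.neg-involutive _)
  ... | no ne = begin
      fire s p u x + nbr (m s u) (fire s p s) x
        ≡⟨ cong₂ _+_ (fire-other s p u x ne) (nbr-cong (m s u) (fire-self s p) x) ⟩
      p u x + nbr (m s u) (p s) x + nbr (m s u) (λ y → - p s y) x
        ≡⟨ ℤₚ.+-assoc (p u x) _ _ ⟩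
      p u x + (nbr (m s u) (p s) x + nbr (m s u) (λ y → - p s y) x)
        ≡⟨ cong (λ z → p u x + z) (nbr-neg (m s u) (p s) x) ⟩
      p u x + 0ℤ ≡⟨ ℤₚ.+-identityʳ _ ⟩
      p u x ∎
    where open ≡-Reasoning

  module Braid (s t : Fin n) (s≢t : s ≢ t) where
    M = m s t
    t≢s : t ≢ s
    t≢s e = s≢t (sym e)

    -- the values of the letters fired successively by s t s t …
    fired : State → ℕ → ℕ → ℤ
    fired p zero x = p s x
    fired p (suc zero) x = p t x + nbr M (p s) x
    fired p (suc (suc j)) x = - fired p j x + nbr M (fired p (suc j)) x

    round : State → State
    round p = fire t (fire s p)

    round-s : ∀ p x → round p s x ≡ fired p 2 x
    round-s p x = trans (fire-other t (fire s p) s x s≢t)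
      (cong₂ _+_ (fire-self s p x) (trans (cong (λ M′ → nbr M′ (fire s p t) x) (proj₁ (proj₂ cox) t s)) (nbr-cong M (λ y → fire-other s p t y t≢s) x)))

    round-t : ∀ p x → round p t x ≡ - fired p 1 x
    round-t p x = trans (fire-self t (fire s p) x) (cong -_ (fire-other s p t x t≢s))

    round-u : ∀ p u x → u ≢ s → u ≢ t → round p u x ≡ p u x + nbr (m s u) (fired p 0) x + nbr (m t u) (fired p 1) x
    round-u p u x u≢s u≢t = trans (fire-other t (fire s p) u x u≢t)
      (cong₂ _+_ (fire-other s p u x u≢s) (nbr-cong (m t u) (λ y → fire-other s p t y t≢s) x))

    fired-round : ∀ p j x → fired (round p) j x ≡ fired p (suc (suc j)) x
    fired-round p zero x = round-s p x
    fired-round p (suc zero) x = cong₂ _+_ (round-t p x) (nbr-cong M (round-s p) x)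
    fired-round p (suc (suc j)) x = cong₂ (λ y z → - y + z) (fired-round p j x) (nbr-cong M (fired-round p (suc j)) x)

    rounds-s : ∀ k p x → play (pow k s t) p s x ≡ fired p (k +ⁿ k) x
    rounds-s zero p x = refl
    rounds-s (suc k) p x = trans (rounds-s k (round p) x)
      (trans (fired-round p (k +ⁿ k) x) (cong (λ j → fired p (suc j) x) (sym (ℕₚ.+-suc k k))))

    rounds-t : ∀ k p x → play (pow k s t) p t x + nbr M (play (pow k s t) p s) x ≡ fired p (suc (k +ⁿ k)) x
    rounds-t zero p x = refl
    rounds-t (suc k) p x = trans (rounds-t k (round p) x)
      (trans (fired-round p (suc (k +ⁿ k)) x) (cong (λ j → fired p (suc (suc j)) x) (sym (ℕₚ.+-suc k k))))

    rounds-u : ∀ k p u x → u ≢ s → u ≢ t → play (pow k s t) p u x ≡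
      p u x + (Σ₂ k 0 (λ i → nbr (m s u) (fired p i) x) + Σ₂ k 1 (λ i → nbr (m t u) (fired p i) x))
    rounds-u zero p u x _ _ = sym (ℤₚ.+-identityʳ _)
    rounds-u (suc k) p u x u≢s u≢t = begin
      play (pow k s t) (round p) u x
        ≡⟨ rounds-u k (round p) u x u≢s u≢t ⟩
      round p u x + (Σ₂ k 0 (λ i → nbr (m s u) (fired (round p) i) x) + Σ₂ k 1 (λ i → nbr (m t u) (fired (round p) i) x))
        ≡⟨ cong₂ _+_ (round-u p u x u≢s u≢t) (cong₂ _+_ (shift (m s u) 0) (shift (m t u) 1)) ⟩
      p u x + nbr (m s u) (fired p 0) x + nbr (m t u) (fired p 1) x + (Σ₂ k 2 (λ i → nbr (m s u) (fired p i) x) + Σ₂ k 3 (λ i → nbr (m t u) (fired p i) x))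
        ≡⟨ regroup (p u x) (nbr (m s u) (fired p 0) x) (nbr (m t u) (fired p 1) x) (Σ₂ k 2 (λ i → nbr (m s u) (fired p i) x)) (Σ₂ k 3 (λ i → nbr (m t u) (fired p i) x)) ⟩
      p u x + (Σ₂ (suc k) 0 (λ i → nbr (m s u) (fired p i) x) + Σ₂ (suc k) 1 (λ i → nbr (m t u) (fired p i) x)) ∎
      where
      open ≡-Reasoning
      shift : ∀ M′ j → Σ₂ k j (λ i → nbr M′ (fired (round p) i) x) ≡ Σ₂ k (suc (suc j)) (λ i → nbr M′ (fired p i) x)
      shift M′ j = trans (Σ₂-cong k j (λ i → nbr-cong M′ (fired-round p i) x)) (sym (Σ₂-suc² k j (λ i → nbr M′ (fired p i) x)))
      regroup : ∀ p a b c d → p + a + b + (c + d) ≡ p + ((a + c) + (b + d))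
      regroup = solve-∀

    -- The values at `s` and `t` return because waves have period `2M`. Any other letter has gained
    -- neighbour sums of the fired values over one period at each parity of time, and those sums are
    -- zero.
    braid-trivial : M ≢ 0 → ∀ p → play (pow M s t) p ≐ p
    braid-trivial M≢0 p u x = go (u ≟ᶠ s) (u ≟ᶠ t)
      where
      2≤M : 2 ≤ⁿ M
      2≤M = two M M≢0 (proj₂ (proj₂ cox) s t s≢t)
        where
        two : ∀ k → k ≢ 0 → k ≢ 1 → 2 ≤ⁿ k
        two zero z _ = ⊥-elim (z refl)
        two (suc zero) _ o = ⊥-elim (o refl)
        two (suc (suc k)) _ _ = s≤s (s≤s z≤n)
      open Recurrence M 2≤M (fired p) (λ j x → refl)
      at-s : ∀ x → play (pow M s t) p s x ≡ p s x
      at-s x = trans (rounds-s M p x) (trans (cong (λ j → fired p (M +ⁿ j) x) (sym (ℕₚ.+-identityʳ M))) (periodic 0 x))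
      -- `rounds-t` controls the value at `t` only together with the neighbour term of `s`; `at-s`
      -- allows this term to be cancelled.
      at-t : ∀ x → play (pow M s t) p t x ≡ p t x
      at-t x = ℤ-cancelʳ (nbr M (p s) x) _ _ (trans (cong (λ z → play (pow M s t) p t x + z) (sym (nbr-cong M at-s x)))
        (trans (rounds-t M p x) (trans (cong (λ j → fired p j x) (trans (cong suc (cong (M +ⁿ_) (sym (ℕₚ.+-identityʳ M)))) (trans (sym (ℕₚ.+-suc M (M +ⁿ 0))) (cong (M +ⁿ_) (sym (ℕₚ.+-suc M 0)))))) (periodic 1 x))))
      vanish : ∀ M′ j → Σ₂ M j (λ i → nbr M′ (fired p i) x) ≡ 0ℤ
      vanish M′ j = trans (sym (nbr-Σ₂ M′ M j (fired p) x)) (trans (nbr-cong M′ (sum-zero j) x) (nbr-0 M′ x))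
      go : _ → _ → play (pow M s t) p u x ≡ p u x
      go (yes refl) _ = at-s x
      go (no _) (yes refl) = at-t x
      go (no u≢s) (no u≢t) = trans (rounds-u M p u x u≢s u≢t)
        (trans (cong (λ z → p u x + z) (cong₂ _+_ (vanish (m s u) 0) (vanish (m t u) 1))) (ℤₚ.+-identityʳ _))

  play-resp : ∀ {u v} → Equiv m u v → ∀ p → play u p ≐ play v p
  play-resp (rel s t m≢0) p with s ≟ᶠ t
  ... | yes refl rewrite proj₁ cox s = play-square s p
  ... | no s≢t = Braid.braid-trivial s t s≢t m≢0 p
  play-resp (ctx u v x y e) p
    rewrite play-++ u (x ++ v) p | play-++ u (y ++ v) p | play-++ x v (play u p) | play-++ y v (play u p)
    = play-cong v (play-resp e (play u p))
  play-resp (≈refl x) p u y = refl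
  play-resp (≈sym e) p u x = sym (play-resp e p u x)
  play-resp (≈trans e f) p u x = trans (play-resp e p u x) (play-resp f p u x)

  -- Separating the two alternating words of equal length

  δ : ℕ → ℕ → ℤ
  δ zero zero = 1ℤ
  δ zero (suc _) = 0ℤ
  δ (suc _) zero = 0ℤ
  δ (suc k) (suc x) = δ k x

  δ-refl : ∀ k → δ k k ≡ 1ℤ
  δ-refl zero = refl
  δ-refl (suc k) = δ-refl k

  δ⁻ : ℕ → ℕ → ℤ
  δ⁻ zero x = 0ℤ
  δ⁻ (suc k) x = δ k x

  δ-suc : ∀ k x → δ k (suc x) ≡ δ⁻ k x
  δ-suc zero x = refl
  δ-suc (suc k) x = refl

  δ-≢ : ∀ k x → k ≢ x → δ k x ≡ 0ℤ
  δ-≢ zero zero ne = ⊥-elim (ne refl)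
  δ-≢ zero (suc x) ne = refl
  δ-≢ (suc k) zero ne = refl
  δ-≢ (suc k) (suc x) ne = δ-≢ k x (λ e → ne (cong suc e))

  -- `suc x <∞ M` says that `x` lies on the first path. The stronger bound on `k` keeps `suc k` on
  -- it as well, so the right-hand neighbour is not lost.
  nbr-δ : ∀ M k x → suc (suc k) <∞ M → suc x <∞ M → nbr M (δ k) x ≡ δ (suc k) x + δ⁻ k x
  nbr-δ M k x hk hx = cong₂ _+_ (low x hx) up
    where
    low : ∀ x → suc x <∞ M → below M (δ k) x ≡ δ (suc k) x
    low zero _ = refl
    low (suc x) h = cong (λ r → guard r (δ k x)) (trans (cong (rank M) (cong suc (sym (ℕₚ.+-identityʳ x)))) (rank-block M 0 (suc x) refl h))
    up : above M (δ k) x ≡ δ⁻ k x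
    up = trans (cong (λ r → guard (next M r) (δ k (suc x))) (trans (cong (rank M) (sym (ℕₚ.+-identityʳ x))) (rank-block M 0 x refl hx))) up′
      where
      up′ : guard (next M x) (δ k (suc x)) ≡ δ⁻ k x
      up′ with suc (suc x) ≟ⁿ M
      ... | no _ = δ-suc k x
      ... | yes refl = trans (sym (δ-≢ k (suc x) (λ { refl → ne hk }))) (δ-suc k x)
        where
        ne : ¬ (suc (suc (suc x)) <∞ suc (suc x))
        ne (inj₁ lt) = ℕₚ.<-irrefl refl (ℕₚ.≤-trans (s≤s (ℕₚ.n≤1+n _)) lt)
        ne (inj₂ ())

  -- The last letter of `alt (suc k) c d`, that is, the letter due to be fired after `alt k c d`.
  parity : ℕ → Fin n → Fin n → Fin n
  parity zero c d = c
  parity (suc k) c d = parity k d c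

  last-fired : ∀ k c d p x → play (alt (suc k) c d) p (parity k c d) x ≡ - play (alt k c d) p (parity k c d) x
  last-fired zero c d p x = fire-self c p x
  last-fired (suc k) c d p x = last-fired k d c (fire c p) x

  module _ (s t : Fin n) (s≢t : s ≢ t) where
    private
      M = m s t

    -- A unit travels along the first path, one vertex per firing.
    travel : ∀ k i c d → c ≢ d → m c d ≡ M → suc (i +ⁿ k) <∞ M → ∀ p →
      (∀ x → suc x <∞ M → p c x ≡ δ i x) → (∀ x → suc x <∞ M → p d x ≡ - δ⁻ i x) →
      ∀ x → suc x <∞ M → play (alt k c d) p (parity k c d) x ≡ δ (i +ⁿ k) x
    travel zero i c d c≢d e hM p hc hd x hx = trans (hc x hx) (cong (λ j → δ j x) (sym (ℕₚ.+-identityʳ i)))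
    travel (suc k) i c d c≢d e hM p hc hd x hx =
      trans (travel k (suc i) d c (λ e → c≢d (sym e)) (trans (proj₁ (proj₂ cox) d c) e) hM′ (fire c p) hc′ hd′ x hx)
            (cong (λ j → δ j x) (sym (ℕₚ.+-suc i k)))
      where
      hM′ : suc (suc i +ⁿ k) <∞ M
      hM′ = subst (λ j → suc j <∞ M) (ℕₚ.+-suc i k) hM
      bound : ∀ j → suc (suc i +ⁿ j) <∞ M → suc (suc i) <∞ M
      bound j (inj₁ lt) = inj₁ (ℕₚ.≤-trans (s≤s (s≤s (s≤s (ℕₚ.m≤m+n i j)))) lt)
      bound j (inj₂ z) = inj₂ z
      local : ∀ x → suc x <∞ M → nbr (m c d) (p c) x ≡ nbr M (δ i) x
      local x hx = trans (cong (λ M′ → nbr M′ (p c) x) e) (cong₂ _+_ (lo x hx) hi)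
        where
        lo : ∀ x → suc x <∞ M → below M (p c) x ≡ below M (δ i) x
        lo zero _ = refl
        lo (suc x) h = cong (guard (rank M (suc x))) (hc x (<∞-pred h))
        hi : above M (p c) x ≡ above M (δ i) x
        hi = subst (λ r → guard (next M r) (p c (suc x)) ≡ guard (next M r) (δ i (suc x)))
               (sym (trans (cong (rank M) (sym (ℕₚ.+-identityʳ x))) (rank-block M 0 x refl hx))) hi′
          where
          hi′ : guard (next M x) (p c (suc x)) ≡ guard (next M x) (δ i (suc x))
          hi′ with suc (suc x) ≟ⁿ M
          ... | yes _ = refl
          ... | no ne = hc (suc x) (inside hx)
            where
            inside : suc x <∞ M → suc (suc x) <∞ M
            inside (inj₁ lt) = inj₁ (ℕₚ.≤∧≢⇒< lt ne)
            inside (inj₂ z) = inj₂ z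
      hc′ : ∀ x → suc x <∞ M → fire c p d x ≡ δ (suc i) x
      hc′ x hx = trans (fire-other c p d x (λ e → c≢d (sym e)))
        (trans (cong₂ _+_ (hd x hx) (trans (local x hx) (nbr-δ M i x (bound k hM′) hx)))
               (cancel (δ⁻ i x) (δ (suc i) x)))
        where
        cancel : ∀ a b → - a + (b + a) ≡ b
        cancel = solve-∀
      hd′ : ∀ x → suc x <∞ M → fire c p c x ≡ - δ⁻ (suc i) x
      hd′ x hx = trans (fire-self c p x) (cong -_ (hc x hx))

    start : State
    start u x with u ≟ᶠ t
    ... | yes _ = δ 0 x
    ... | no _ = 0ℤ

    start-t : ∀ x → start t x ≡ δ 0 x
    start-t x with t ≟ᶠ t
    ... | yes _ = refl
    ... | no ne = ⊥-elim (ne refl)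

    start-s : ∀ x → start s x ≡ 0ℤ
    start-s x with s ≟ᶠ t
    ... | yes e = ⊥-elim (s≢t e)
    ... | no _ = refl

    fire-start : fire s start ≐ start
    fire-start u x with u ≟ᶠ s
    ... | yes refl = trans (cong -_ (start-s x)) (sym (start-s x))
    ... | no _ = trans (cong (λ z → start u x + z) (trans (nbr-cong (m s u) start-s x) (nbr-0 (m s u) x))) (ℤₚ.+-identityʳ _)

    -- From `start`, firing `alt k t s` carries the unit to vertex `k` of the letter due next.
    -- Firing `s` beforehand changes nothing, so the first word ends with the value 1 there; the
    -- second word fires that letter as well and ends with -1.
    alt-distinct : ∀ k → suc k <∞ M → ¬ Equiv m (alt (suc k) s t) (alt (suc k) t s)
    alt-distinct k h e = absurd (trans (sym v₂) (trans (sym (play-resp e start (parity k t s) k)) v₁))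
      where
      unit : play (alt k t s) start (parity k t s) k ≡ 1ℤ
      unit = trans (travel k 0 t s (λ e → s≢t (sym e)) (proj₁ (proj₂ cox) t s) h start (λ x _ → start-t x) (λ x _ → start-s x) k h) (δ-refl k)
      v₁ : play (alt k t s) (fire s start) (parity k t s) k ≡ 1ℤ
      v₁ = trans (play-cong (alt k t s) fire-start (parity k t s) k) unit
      v₂ : play (alt (suc k) t s) start (parity k t s) k ≡ - 1ℤ
      v₂ = trans (last-fired k t s start k) (cong -_ unit)
      absurd : - 1ℤ ≢ 1ℤ
      absurd ()

-- Reflections and the exchange property

pow-snoc : ∀ {n} k (s t : Fin n) → pow k s t ++ s ∷ t ∷ [] ≡ pow (suc k) s t
pow-snoc zero s t = refl
pow-snoc (suc k) s t = cong (λ w → s ∷ t ∷ w) (pow-snoc k s t)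

pow-+ : ∀ {n} k l (s t : Fin n) → pow (k +ⁿ l) s t ≡ pow k s t ++ pow l s t
pow-+ zero l s t = refl
pow-+ (suc k) l s t = cong (λ w → s ∷ t ∷ w) (pow-+ k l s t)

applyUpTo-+ : ∀ {A : Set} (f : ℕ → A) k l → applyUpTo f (k +ⁿ l) ≡ applyUpTo f k ++ applyUpTo (λ i → f (k +ⁿ i)) l
applyUpTo-+ f zero l = refl
applyUpTo-+ f (suc k) l = cong (f 0 ∷_) (applyUpTo-+ (λ i → f (suc i)) k l)

applyUpTo-cong : ∀ {A : Set} {f g : ℕ → A} k → (∀ i → f i ≡ g i) → applyUpTo f k ≡ applyUpTo g k
applyUpTo-cong zero h = refl
applyUpTo-cong (suc k) h = cong₂ _∷_ (h 0) (applyUpTo-cong k (λ i → h (suc i)))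

module Words {n : ℕ} (m : CoxMat n) (cox : IsCoxeterMatrix m) where

  Word : Set
  Word = List (Fin n)

  infix 4 _≈_
  _≈_ : Word → Word → Set
  _≈_ = Equiv m

  ≡⇒≈ : ∀ {u v} → u ≡ v → u ≈ v
  ≡⇒≈ refl = ≈refl _

  ++-congˡ : ∀ w {u v} → u ≈ v → w ++ u ≈ w ++ v
  ++-congˡ w {u} {v} e = subst₂ _≈_ (cong (w ++_) (++-identityʳ u)) (cong (w ++_) (++-identityʳ v)) (ctx w [] u v e)

  ++-congʳ : ∀ w {u v} → u ≈ v → u ++ w ≈ v ++ w
  ++-congʳ w {u} {v} e = ctx [] w u v e

  ++-cong : ∀ {u v u′ v′} → u ≈ v → u′ ≈ v′ → u ++ u′ ≈ v ++ v′
  ++-cong {v = v} {u′} e f = ≈trans (++-congʳ u′ e) (++-congˡ v f)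

  ∷-cong : ∀ s {u v} → u ≈ v → s ∷ u ≈ s ∷ v
  ∷-cong s = ++-congˡ [ s ]

  square : ∀ s → s ∷ s ∷ [] ≈ []
  square s = subst (λ k → pow k s s ≈ []) (proj₁ cox s)
               (rel s s (λ e → case trans (sym (proj₁ cox s)) e of λ ()))

  ∷-square : ∀ s u → s ∷ s ∷ u ≈ u
  ∷-square s u = ++-congʳ u (square s)

  inv : Word → Word
  inv [] = []
  inv (s ∷ u) = inv u ++ [ s ]

  inverseˡ : ∀ u → inv u ++ u ≈ []
  inverseˡ [] = ≈refl []
  inverseˡ (s ∷ u) = ≈trans (≡⇒≈ (++-assoc (inv u) [ s ] (s ∷ u)))
    (≈trans (++-congˡ (inv u) (∷-square s u)) (inverseˡ u))

  inverseʳ : ∀ u → u ++ inv u ≈ []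
  inverseʳ [] = ≈refl []
  inverseʳ (s ∷ u) = ≈trans (∷-cong s (≈trans (≡⇒≈ (sym (++-assoc u (inv u) [ s ]))) (++-congʳ [ s ] (inverseʳ u)))) (square s)

  inv-cong : ∀ {u v} → u ≈ v → inv u ≈ inv v
  inv-cong {u} {v} e =
    ≈trans (≈trans (≡⇒≈ (sym (++-identityʳ (inv u)))) (++-congˡ (inv u) (≈sym (inverseʳ v))))
    (≈trans (≈trans (≡⇒≈ (sym (++-assoc (inv u) v (inv v)))) (++-congʳ (inv v) (++-congˡ (inv u) (≈sym e))))
            (++-congʳ (inv v) (inverseˡ u)))

  group : Group _ _
  group = record
    { Carrier = Word ; _≈_ = _≈_ ; _∙_ = _++_ ; ε = [] ; _⁻¹ = inv
    ; isGroup = record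
      { isMonoid = record
        { isSemigroup = record
          { isMagma = record
            { isEquivalence = record { refl = ≈refl _ ; sym = ≈sym ; trans = ≈trans }
            ; ∙-cong = ++-cong }
          ; assoc = λ u v w → ≡⇒≈ (++-assoc u v w) }
        ; identity = (λ u → ≈refl u) , (λ u → ≡⇒≈ (++-identityʳ u)) }
      ; inverse = inverseˡ , inverseʳ
      ; ⁻¹-cong = inv-cong } }

  open GroupProperties group public using () renaming (∙-cancelˡ to ++-cancelˡ; ∙-cancelʳ to ++-cancelʳ)

  module ≈-Reasoning = SetoidReasoning (Group.setoid group)

  ∷-cancel : ∀ s {u v} → s ∷ u ≈ s ∷ v → u ≈ v
  ∷-cancel s {u} {v} = ++-cancelˡ [ s ] u v

  ∷-move : ∀ s {u v} → s ∷ u ≈ v → u ≈ s ∷ v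
  ∷-move s {u} e = ≈trans (≈sym (∷-square s u)) (∷-cong s e)

  reduced-resp : ∀ {u v} → Reduced m u → v ≈ u → length v ≤ⁿ length u → Reduced m v
  reduced-resp r e le w f = ℕₚ.≤-trans le (r w (≈trans f e))

  reduced-++ˡ : ∀ u v → Reduced m (u ++ v) → Reduced m u
  reduced-++ˡ u v r w e = ℕₚ.+-cancelʳ-≤ (length v) (length u) (length w)
    (subst₂ _≤ⁿ_ (length-++ u) (length-++ w) (r (w ++ v) (++-congʳ v e)))

  reduced-++ʳ : ∀ u v → Reduced m (u ++ v) → Reduced m v
  reduced-++ʳ u v r w e = ℕₚ.+-cancelˡ-≤ (length u) (length v) (length w)
    (subst₂ _≤ⁿ_ (length-++ u) (length-++ u) (r (u ++ w) (++-congˡ u e)))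

  reduced-tail : ∀ {s u} → Reduced m (s ∷ u) → Reduced m u
  reduced-tail {s} {u} = reduced-++ʳ [ s ] u

  reduced-length : ∀ {u v} → Reduced m u → Reduced m v → u ≈ v → length u ≡ length v
  reduced-length r r′ e = ℕₚ.≤-antisym (r _ (≈sym e)) (r′ _ e)

  -- Being reduced is a family of decidable inequalities, so it may be concluded from facts known
  -- only up to double negation.
  reduced-stable : ∀ {u} → ¬ ¬ Reduced m u → Reduced m u
  reduced-stable {u} h v e = decidable-stable (length u ≤?ⁿ length v) (λ ¬le → h (λ r → ¬le (r v e)))

  conj : Fin n → Word → Word
  conj s u = s ∷ u ++ [ s ]

  conjBy : Word → Word → Word
  conjBy [] u = u
  conjBy (s ∷ w) u = conj s (conjBy w u)

  conjBy-≈ : ∀ w u → conjBy w u ≈ w ++ u ++ inv w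
  conjBy-≈ [] u = ≡⇒≈ (sym (++-identityʳ u))
  conjBy-≈ (s ∷ w) u = ∷-cong s (≈trans (++-congʳ [ s ] (conjBy-≈ w u))
    (≡⇒≈ (trans (++-assoc w _ [ s ]) (cong (w ++_) (++-assoc u (inv w) [ s ])))))

  conjBy-cong : ∀ {w w′ u u′} → w ≈ w′ → u ≈ u′ → conjBy w u ≈ conjBy w′ u′
  conjBy-cong {w} {w′} {u} {u′} e f = ≈trans (conjBy-≈ w u)
    (≈trans (++-cong e (++-cong f (inv-cong e))) (≈sym (conjBy-≈ w′ u′)))

  conjBy-inverseʳ : ∀ w u → conjBy w (conjBy (inv w) u) ≈ u
  conjBy-inverseʳ w u = begin
    conjBy w (conjBy (inv w) u)                   ≈⟨ conjBy-≈ w _ ⟩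
    w ++ conjBy (inv w) u ++ inv w                ≈⟨ ++-congˡ w (++-congʳ (inv w) (conjBy-≈ (inv w) u)) ⟩
    w ++ (inv w ++ u ++ inv (inv w)) ++ inv w     ≡⟨ cong (w ++_) (trans (++-assoc (inv w) _ (inv w)) (cong (inv w ++_) (++-assoc u _ (inv w)))) ⟩
    w ++ inv w ++ u ++ inv (inv w) ++ inv w       ≡⟨ sym (++-assoc w (inv w) _) ⟩
    (w ++ inv w) ++ u ++ inv (inv w) ++ inv w     ≈⟨ ++-cong (inverseʳ w) (++-congˡ u (inverseˡ (inv w))) ⟩
    u ++ []                                       ≡⟨ ++-identityʳ u ⟩
    u ∎
    where open ≈-Reasoning

  conjBy-cancel : ∀ w {u v} → conjBy w u ≈ conjBy w v → u ≈ v
  conjBy-cancel w {u} {v} e = ++-cancelʳ (inv w) u v (++-cancelˡ w _ _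
    (≈trans (≈sym (conjBy-≈ w u)) (≈trans e (conjBy-≈ w v))))

  conjBy-swap : ∀ w {s t} → conjBy w [ t ] ≈ [ s ] → s ∷ w ≈ w ++ [ t ]
  conjBy-swap w {s} {t} e = ++-cancelʳ (inv w) _ _ (begin
    s ∷ w ++ inv w          ≈⟨ ∷-cong s (inverseʳ w) ⟩
    [ s ]                   ≈⟨ ≈sym e ⟩
    conjBy w [ t ]          ≈⟨ conjBy-≈ w [ t ] ⟩
    w ++ t ∷ inv w          ≡⟨ sym (++-assoc w [ t ] (inv w)) ⟩
    (w ++ [ t ]) ++ inv w   ∎)
    where open ≈-Reasoning

  -- For u = s₁ … sₖ: the reflections s₁ … sᵢ … s₁.
  reflections : Word → List Word
  reflections [] = []
  reflections (s ∷ u) = [ s ] ∷ map (conj s) (reflections u)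

  reflections-++ : ∀ u v → reflections (u ++ v) ≡ reflections u ++ map (conjBy u) (reflections v)
  reflections-++ [] v = sym (map-id (reflections v))
  reflections-++ (s ∷ u) v = cong ([ s ] ∷_) (trans (cong (map (conj s)) (reflections-++ u v))
    (trans (map-++ (conj s) (reflections u) _) (cong (map (conj s) (reflections u) ++_) (sym (map-∘ (reflections v))))))

  -- Parity of the number of entries equal to t in W. It is a relation because equality in W
  -- is not yet known to be decidable; its values exist only up to double negation.
  data Parity (t : Word) : List Word → Bool → Set where
    []   : Parity t [] false
    hit  : ∀ {r rs b} → r ≈ t → Parity t rs b → Parity t (r ∷ rs) (not b)
    miss : ∀ {r rs b} → ¬ r ≈ t → Parity t rs b → Parity t (r ∷ rs) b

  parity-exists : ∀ t rs → ¬ ¬ (∃[ b ] Parity t rs b)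
  parity-exists t [] k = k (false , [])
  parity-exists t (r ∷ rs) k = parity-exists t rs (λ (b , p) →
    ¬¬-excluded-middle {A = r ≈ t} λ { (yes e) → k (not b , hit e p) ; (no ne) → k (b , miss ne p) })

  parity-unique : ∀ {t t′ rs rs′ a b} → t ≈ t′ → Pointwise _≈_ rs rs′ → Parity t rs a → Parity t′ rs′ b → a ≡ b
  parity-unique e [] [] [] = refl
  parity-unique e (_ ∷ es) (hit _ p) (hit _ q) = cong not (parity-unique e es p q)
  parity-unique e (_ ∷ es) (miss _ p) (miss _ q) = parity-unique e es p q
  parity-unique e (f ∷ es) (hit h p) (miss nh q) = ⊥-elim (nh (≈trans (≈sym f) (≈trans h e)))
  parity-unique e (f ∷ es) (miss nh p) (hit h q) = ⊥-elim (nh (≈trans f (≈trans h (≈sym e))))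

  parity-resp : ∀ {t t′ rs b} → t ≈ t′ → Parity t rs b → Parity t′ rs b
  parity-resp e [] = []
  parity-resp e (hit h p) = hit (≈trans h e) (parity-resp e p)
  parity-resp e (miss nh p) = miss (λ h → nh (≈trans h (≈sym e))) (parity-resp e p)

  parity-++ : ∀ {t rs rs′ a b} → Parity t rs a → Parity t rs′ b → Parity t (rs ++ rs′) (a xor b)
  parity-++ [] q = q
  parity-++ {b = b} (hit {b = a} h p) q rewrite sym (not-distribˡ-xor a b) = hit h (parity-++ p q)
  parity-++ (miss nh p) q = miss nh (parity-++ p q)

  parity-conjBy : ∀ w {t rs b} → Parity t rs b → Parity (conjBy w t) (map (conjBy w) rs) b
  parity-conjBy w [] = []
  parity-conjBy w (hit h p) = hit (conjBy-cong (≈refl w) h) (parity-conjBy w p)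
  parity-conjBy w (miss nh p) = miss (λ h → nh (conjBy-cancel w h)) (parity-conjBy w p)

  applyUpTo-≈ : ∀ {f g : ℕ → Word} k → (∀ i → f i ≈ g i) → Pointwise _≈_ (applyUpTo f k) (applyUpTo g k)
  applyUpTo-≈ zero h = []
  applyUpTo-≈ (suc k) h = h 0 ∷ applyUpTo-≈ k (λ i → h (suc i))

  reflections-pow : ∀ k s t → reflections (pow k s t) ≡ applyUpTo (λ i → pow i s t ++ [ s ]) (k +ⁿ k)
  reflections-pow zero s t = refl
  reflections-pow (suc k) s t = begin
    [ s ] ∷ conj s [ t ] ∷ map (conj s) (map (conj t) (reflections (pow k s t)))
      ≡⟨ cong (λ rs → [ s ] ∷ conj s [ t ] ∷ rs) (begin
          map (conj s) (map (conj t) (reflections (pow k s t)))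
            ≡⟨ cong (λ rs → map (conj s) (map (conj t) rs)) (reflections-pow k s t) ⟩
          map (conj s) (map (conj t) (applyUpTo (λ i → pow i s t ++ [ s ]) (k +ⁿ k)))
            ≡⟨ cong (map (conj s)) (map-applyUpTo _ (conj t) (k +ⁿ k)) ⟩
          map (conj s) (applyUpTo (λ i → conj t (pow i s t ++ [ s ])) (k +ⁿ k))
            ≡⟨ map-applyUpTo _ (conj s) (k +ⁿ k) ⟩
          applyUpTo (λ i → conj s (conj t (pow i s t ++ [ s ]))) (k +ⁿ k)
            ≡⟨ applyUpTo-cong (k +ⁿ k) shift ⟩
          applyUpTo (λ i → pow (2 +ⁿ i) s t ++ [ s ]) (k +ⁿ k) ∎) ⟩
    applyUpTo (λ i → pow i s t ++ [ s ]) (2 +ⁿ (k +ⁿ k))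
      ≡⟨ cong (applyUpTo (λ i → pow i s t ++ [ s ])) (cong suc (sym (ℕₚ.+-suc k k))) ⟩
    applyUpTo (λ i → pow i s t ++ [ s ]) (suc k +ⁿ suc k) ∎
    where
    open ≡-Reasoning
    shift : ∀ i → conj s (conj t (pow i s t ++ [ s ])) ≡ pow (2 +ⁿ i) s t ++ [ s ]
    shift i = cong (λ w → s ∷ t ∷ w) (begin
      ((pow i s t ++ [ s ]) ++ [ t ]) ++ [ s ] ≡⟨ cong (_++ [ s ]) (++-assoc (pow i s t) [ s ] [ t ]) ⟩
      (pow i s t ++ s ∷ t ∷ []) ++ [ s ]       ≡⟨ cong (_++ [ s ]) (pow-snoc i s t) ⟩
      pow (suc i) s t ++ [ s ]                 ∎)

  -- The reflections of (st)^m recur with period m.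
  parity-braid : ∀ s t → m s t ≢ 0 → ∀ r {b} → Parity r (reflections (pow (m s t) s t)) b → b ≡ false
  parity-braid s t m≢0 r {b} p = decidable-stable (b ≟ᵇ false) λ b≢ →
    parity-exists r (applyUpTo f M) λ (a , q) →
    parity-exists r (applyUpTo (λ i → f (M +ⁿ i)) M) λ (a′ , q′) →
    b≢ (trans (parity-unique (≈refl r) (Pw.refl (≈refl _)) p (subst (λ rs → Parity r rs _) split (parity-++ q q′)))
       (trans (cong (a xor_) (sym (parity-unique (≈refl r) (applyUpTo-≈ M period) q q′))) (xor-same a)))
    where
    M = m s t
    f : ℕ → Word
    f i = pow i s t ++ [ s ]
    split : applyUpTo f M ++ applyUpTo (λ i → f (M +ⁿ i)) M ≡ reflections (pow M s t)
    split = sym (trans (reflections-pow M s t) (applyUpTo-+ f M M))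
    period : ∀ i → f i ≈ f (M +ⁿ i)
    period i = ++-congʳ [ s ] (≈sym (≈trans (≡⇒≈ (pow-+ M i s t)) (++-congʳ (pow i s t) (rel s t m≢0))))

  -- A relator contributes every reflection an even number of times, and the reflections of a later
  -- factor are conjugated by the element before it, not by its spelling. Equality of booleans is
  -- stable, so parities that exist only up to double negation suffice.
  parity-invariant : ∀ {u v} → u ≈ v → ∀ t {a b} → Parity t (reflections u) a → Parity t (reflections v) b → a ≡ b
  parity-invariant (rel s t m≢0) r p [] = parity-braid s t m≢0 r p
  parity-invariant (≈refl u) t p q = parity-unique (≈refl t) (Pw.refl (≈refl _)) p q
  parity-invariant (≈sym e) t p q = sym (parity-invariant e t q p)
  parity-invariant (≈trans {y = y} e f) t {a} {b} p q = decidable-stable (a ≟ᵇ b) λ a≢b →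
    parity-exists t (reflections y) λ (c , r) →
    a≢b (trans (parity-invariant e t p r) (parity-invariant f t r q))
  parity-invariant (ctx u v x y e) t {a} {b} p q = decidable-stable (a ≟ᵇ b) λ a≢b →
    parity-exists t (reflections u) λ (a₀ , p₀) →
    parity-exists t′ (reflections x) λ (a₁ , p₁) →
    parity-exists t′ (reflections y) λ (b₁ , q₁) →
    parity-exists t (map (conjBy u) (map (conjBy x) (reflections v))) λ (a₂ , p₂) →
    parity-exists t (map (conjBy u) (map (conjBy y) (reflections v))) λ (b₂ , q₂) →
    a≢b (trans (total x p₀ p₁ p₂ p) (trans (cong₂ (λ c d → a₀ xor (c xor d))
      (parity-invariant e t′ p₁ q₁) (parity-unique (≈refl t) (pointwise (reflections v)) p₂ q₂))
      (sym (total y p₀ q₁ q₂ q))))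
    where
    t′ = conjBy (inv u) t
    total : ∀ z {a₀ a₁ a₂ a} → Parity t (reflections u) a₀ → Parity t′ (reflections z) a₁ →
            Parity t (map (conjBy u) (map (conjBy z) (reflections v))) a₂ →
            Parity t (reflections (u ++ z ++ v)) a → a ≡ a₀ xor (a₁ xor a₂)
    total z p₀ p₁ p₂ p = parity-unique (≈refl t) (Pw.refl (≈refl _)) p
      (subst (λ rs → Parity t rs _) (sym eq)
        (parity-++ p₀ (parity-++ (parity-resp (conjBy-inverseʳ u t) (parity-conjBy u p₁)) p₂)))
      where
      eq : reflections (u ++ z ++ v) ≡ reflections u ++ map (conjBy u) (reflections z) ++ map (conjBy u) (map (conjBy z) (reflections v))
      eq = trans (reflections-++ u (z ++ v)) (cong (reflections u ++_)
             (trans (cong (map (conjBy u)) (reflections-++ z v)) (map-++ (conjBy u) (reflections z) _)))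
    pointwise : ∀ rs → Pointwise _≈_ (map (conjBy u) (map (conjBy x) rs)) (map (conjBy u) (map (conjBy y) rs))
    pointwise [] = []
    pointwise (r ∷ rs) = conjBy-cong (≈refl u) (conjBy-cong e (≈refl r)) ∷ pointwise rs

  -- The equation is imposed on the prefix; `s ∷ u ≈ p ++ q` follows by `exchange-delete`. The
  -- prefix form compares words no longer than `u`, which the induction for the word problem needs,
  -- and it shows where in `u` the deleted letter sits.
  Exchange : Fin n → Word → Set
  Exchange s u = ∃[ p ] ∃[ b ] ∃[ q ] (u ≡ p ++ b ∷ q × s ∷ p ≈ p ++ [ b ])

  exchange-delete : ∀ {s p b} q → s ∷ p ≈ p ++ [ b ] → s ∷ p ++ b ∷ q ≈ p ++ q
  exchange-delete {s} {p} {b} q e = begin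
    s ∷ p ++ b ∷ q          ≈⟨ ++-congʳ (b ∷ q) e ⟩
    (p ++ [ b ]) ++ b ∷ q   ≡⟨ ++-assoc p [ b ] (b ∷ q) ⟩
    p ++ b ∷ b ∷ q          ≈⟨ ++-congˡ p (∷-square b q) ⟩
    p ++ q                  ∎
    where open ≈-Reasoning

  length-delete : ∀ (p : Word) b q → length (p ++ b ∷ q) ≡ suc (length (p ++ q))
  length-delete [] b q = refl
  length-delete (_ ∷ p) b q = cong suc (length-delete p b q)

  any-reflection : ∀ (P : Word → Set) u → Any P (reflections u) →
    ∃[ p ] ∃[ b ] ∃[ q ] (u ≡ p ++ b ∷ q × P (conjBy p [ b ]))
  any-reflection P (s ∷ u) (here px) = [] , s , u , refl , px
  any-reflection P (s ∷ u) (there a) with any-reflection (λ r → P (conj s r)) u (Anyₚ.map⁻ a)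
  ... | p , b , q , refl , px = s ∷ p , b , q , refl , px

  odd⇒any : ∀ {t rs b} → Parity t rs b → b ≡ true → Any (_≈ t) rs
  odd⇒any (hit h p) _ = here h
  odd⇒any (miss _ p) e = there (odd⇒any p e)

  odd⇒exchange : ∀ {s u b} → Parity [ s ] (reflections u) b → b ≡ true → Exchange s u
  odd⇒exchange {s} {u} p e with any-reflection (_≈ [ s ]) u (odd⇒any p e)
  ... | p , b , q , eq , h = p , b , q , eq , conjBy-swap p h

  -- Prepending `s` adds one occurrence of the reflection `s` and conjugates the others by `s`,
  -- which fixes `s`. So if the parity for `u` is even, it is odd for every word `v` of the element
  -- `s ∷ u`. Such a `v` admits an exchange, which leaves a word of `u` one letter shorter than `v`;
  -- hence `s ∷ u` would be reduced.
  exchange-parity : ∀ {s u b} → Reduced m u → ¬ Reduced m (s ∷ u) → Parity [ s ] (reflections u) b → Exchange s u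
  exchange-parity {b = true} r nr p = odd⇒exchange p refl
  exchange-parity {s} {u} {false} r nr p = ⊥-elim (nr (λ v e →
    decidable-stable (suc (length u) ≤?ⁿ length v) (λ longer →
      parity-exists [ s ] (reflections v) (λ (c , q) →
        longer (contra v e (odd⇒exchange q (sym (parity-invariant (≈sym e) [ s ] odd q))))))))
    where
    odd : Parity [ s ] (reflections (s ∷ u)) true
    odd = hit (≈refl _) (parity-resp (∷-square s [ s ]) (parity-conjBy [ s ] p))
    contra : ∀ v → v ≈ s ∷ u → Exchange s v → suc (length u) ≤ⁿ length v
    contra v e (p , b , q , refl , h) = subst (suc (length u) ≤ⁿ_) (sym (length-delete p b q))
      (s≤s (r (p ++ q) (≈trans (≈sym (exchange-delete q h)) (≈trans (∷-cong s e) (∷-square s u)))))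

  exchange-¬¬ : ∀ {s u} → Reduced m u → ¬ Reduced m (s ∷ u) → ¬ ¬ Exchange s u
  exchange-¬¬ {s} {u} r nr k = parity-exists [ s ] (reflections u) λ (b , p) → k (exchange-parity r nr p)

-- The word problem

++-split : ∀ {A : Set} (xs : List A) {ys p b q} → xs ++ ys ≡ p ++ b ∷ q →
  (∃[ zs ] (p ≡ xs ++ zs × ys ≡ zs ++ b ∷ q)) ⊎ (∃[ zs ] (xs ≡ p ++ b ∷ zs × q ≡ zs ++ ys))
++-split [] {p = p} e = inj₁ (p , refl , e)
++-split (x ∷ xs) {p = []} refl = inj₂ (xs , refl , refl)
++-split (x ∷ xs) {p = a ∷ p} e with ∷-injective e
... | refl , e′ with ++-split xs {p = p} e′
...   | inj₁ (zs , refl , e″) = inj₁ (zs , refl , e″)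
...   | inj₂ (zs , refl , e″) = inj₂ (zs , refl , e″)

split? : ∀ {A : Set} (P : List A → A → Set) q →
  (∀ p b q′ → q ≡ p ++ b ∷ q′ → Dec (P p b)) → Dec (∃[ p ] ∃[ b ] ∃[ q′ ] (q ≡ p ++ b ∷ q′ × P p b))
split? P [] d = no λ { ([] , _ , _ , () , _) ; (_ ∷ _ , _ , _ , () , _) }
split? P (x ∷ q) d with d [] x q refl
... | yes h = yes ([] , x , q , refl , h)
... | no ¬h with split? (λ p → P (x ∷ p)) q (λ p b q′ e → d (x ∷ p) b q′ (cong (x ∷_) e))
...   | yes (p , b , q′ , refl , h) = yes (x ∷ p , b , q′ , refl , h)
...   | no ¬t = no λ { ([] , _ , _ , refl , h) → ¬h h
                     ; (_ ∷ p , b , q′ , refl , h) → ¬t (p , b , q′ , refl , h) }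

⊆-++⁻ : ∀ {A : Set} {z : List A} xs {ys} → z ⊆ xs ++ ys → ∃[ a ] ∃[ b ] (z ≡ a ++ b × a ⊆ xs × b ⊆ ys)
⊆-++⁻ [] h = [] , _ , refl , [] , h
⊆-++⁻ (x ∷ xs) (_ ∷ʳ h) with ⊆-++⁻ xs h
... | a , b , e , h₁ , h₂ = a , b , e , x ∷ʳ h₁ , h₂
⊆-++⁻ (x ∷ xs) (refl ∷ h) with ⊆-++⁻ xs h
... | a , b , refl , h₁ , h₂ = x ∷ a , b , refl , refl ∷ h₁ , h₂

⊆-delete : ∀ {A : Set} (p : List A) {b q} → p ++ q ⊆ p ++ b ∷ q
⊆-delete [] = _ ∷ʳ ⊆-refl
⊆-delete (x ∷ p) = refl ∷ ⊆-delete p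

length-alt : ∀ {n} k (s t : Fin n) → length (alt k s t) ≡ k
length-alt zero s t = refl
length-alt (suc k) s t = cong suc (length-alt k t s)

alt-prefix : ∀ {n} k {s t : Fin n} p {b q} → alt k s t ≡ p ++ b ∷ q →
  ∃[ i ] (i <ⁿ k × p ≡ alt i s t × p ++ [ b ] ≡ alt (suc i) s t)
alt-prefix (suc k) [] refl = 0 , s≤s z≤n , refl , refl
alt-prefix (suc k) (x ∷ p) e with ∷-injective e
... | refl , e′ with alt-prefix k p e′
...   | i , lt , refl , eq = suc i , s≤s lt , refl , cong (_ ∷_) eq

alt-⊆ : ∀ {n} {i k} (s t : Fin n) → i ≤ⁿ k → alt i s t ⊆ alt k s t
alt-⊆ s t z≤n = minimum _
alt-⊆ s t (s≤s le) = refl ∷ alt-⊆ t s le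

alt-letters : ∀ {n} {P : Fin n → Set} k {s t} → P s → P t → All P (alt k s t)
alt-letters zero ps pt = []
alt-letters (suc k) ps pt = ps ∷ alt-letters k pt ps

alt-+ : ∀ {n} k l (s t : Fin n) → ∃[ c ] ∃[ d ] (((c ≡ s × d ≡ t) ⊎ (c ≡ t × d ≡ s)) × alt (k +ⁿ l) s t ≡ alt k s t ++ alt l c d)
alt-+ zero l s t = s , t , inj₁ (refl , refl) , refl
alt-+ (suc k) l s t with alt-+ k l t s
... | c , d , inj₁ e , eq = c , d , inj₂ e , cong (s ∷_) eq
... | c , d , inj₂ e , eq = c , d , inj₁ e , cong (s ∷_) eq

module Coxeter {n : ℕ} (m : CoxMat n) (cox : IsCoxeterMatrix m) where
  open Words m cox public

  m-sym : ∀ s t → m s t ≡ m t s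
  m-sym = proj₁ (proj₂ cox)

  alt-distinct : ∀ k s t → suc k <∞ m s t → ¬ alt (suc k) s t ≈ alt (suc k) t s
  alt-distinct k s t h e with s ≟ᶠ t
  ... | no s≢t = NumbersGame.alt-distinct m cox s t s≢t k h e
  ... | yes refl = absurd h (proj₁ cox s)
    where
    absurd : ∀ {M} → suc k <∞ M → ¬ M ≡ 1
    absurd (inj₁ (s≤s ())) refl
    absurd (inj₂ refl) ()

  generator-injective : ∀ {s t} → [ s ] ≈ [ t ] → s ≡ t
  generator-injective {s} {t} e with s ≟ᶠ t
  ... | yes eq = eq
  ... | no s≢t = ⊥-elim (alt-distinct 0 s t (two (m s t) (proj₂ (proj₂ cox) s t s≢t)) e)
    where
    two : ∀ M → M ≢ 1 → 1 <∞ M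
    two zero _ = inj₂ refl
    two (suc zero) ne = ⊥-elim (ne refl)
    two (suc (suc M)) _ = inj₁ (s≤s (s≤s z≤n))

  pow≈alt : ∀ k s t → pow k s t ≈ alt k s t ++ inv (alt k t s)
  pow≈alt zero s t = ≈refl []
  pow≈alt (suc k) s t = ≈trans (≡⇒≈ (rotate k s t))
    (∷-cong s (≈trans (++-congʳ [ t ] (pow≈alt k t s)) (≡⇒≈ (++-assoc (alt k t s) _ [ t ]))))
    where
    rotate : ∀ k (s t : Fin n) → pow (suc k) s t ≡ s ∷ pow k t s ++ [ t ]
    rotate zero s t = refl
    rotate (suc k) s t = cong (λ w → s ∷ t ∷ w) (rotate k s t)

  braid : ∀ s t → m s t ≢ 0 → alt (m s t) s t ≈ alt (m s t) t s
  braid s t m≢0 = begin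
    alt M s t                                      ≡⟨ sym (++-identityʳ _) ⟩
    alt M s t ++ []                                ≈⟨ ++-congˡ (alt M s t) (≈sym (inverseˡ (alt M t s))) ⟩
    alt M s t ++ inv (alt M t s) ++ alt M t s      ≡⟨ sym (++-assoc (alt M s t) _ _) ⟩
    (alt M s t ++ inv (alt M t s)) ++ alt M t s    ≈⟨ ++-congʳ (alt M t s) (≈trans (≈sym (pow≈alt M s t)) (rel s t m≢0)) ⟩
    alt M t s                                      ∎
    where
    M = m s t
    open ≈-Reasoning

  Strip : Word → Word → Set
  Strip cs r = ∃[ x ] (r ≈ cs ++ x × length r ≡ length cs +ⁿ length x)

  strip-reduced : ∀ {cs r} → Reduced m r → ((x , _) : Strip cs r) → Reduced m (cs ++ x)
  strip-reduced {cs} rr (x , e , l) = reduced-resp rr (≈sym e) (ℕₚ.≤-reflexive (trans (length-++ cs) (sym l)))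

  exchange⇒strip : ∀ {s u} → Exchange s u → Strip [ s ] u
  exchange⇒strip {s} (p , b , q , refl , e) = p ++ q , ∷-move s (exchange-delete q e) , length-delete p b q

  strip⇒¬reduced : ∀ {s u} → Strip [ s ] u → ¬ Reduced m (s ∷ u)
  strip⇒¬reduced {s} {u} (x , e , l) r = ℕₚ.<-irrefl refl (ℕₚ.≤-trans (ℕₚ.n≤1+n _)
    (subst (λ k → suc k ≤ⁿ length x) l (r x (≈sym (≈trans (∷-cong s e) (∷-square s x))))))

  -- Induction with the letters swapped gives `w ≈ alt k d c ++ y`, and `c` is exchanged against a
  -- letter of this word. If the letter lies in `y`, then `c` moves to the front. If it lies in the
  -- alternating part, two alternating words of a length below `m c d` coincide, against
  -- `alt-distinct`.
  dihedral-¬¬ : ∀ {w} → Reduced m w → ∀ k c d → k ≤∞ m c d → ¬ Reduced m (c ∷ w) → ¬ Reduced m (d ∷ w) →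
    ¬ ¬ Strip (alt k c d) w
  dihedral-¬¬ {w} r zero c d h nc nd K = K (w , ≈refl w , refl)
  dihedral-¬¬ {w} r (suc k) c d h nc nd K =
    dihedral-¬¬ r k d c (subst (k ≤∞_) (m-sym c d) (≤∞-pred h)) nd nc λ S →
    exchange-¬¬ (strip-reduced r S) (λ r′ → nc (back S r′)) λ X → K (extend S X)
    where
    back : ((y , _) : Strip (alt k d c) w) → Reduced m (c ∷ alt k d c ++ y) → Reduced m (c ∷ w)
    back (y , e , l) r′ = reduced-resp r′ (∷-cong c e) (ℕₚ.≤-reflexive (cong suc (trans l (sym (length-++ (alt k d c))))))
    strictly : ∀ {i} → i <ⁿ k → suc k ≤∞ m c d → suc i <∞ m c d
    strictly lt (inj₁ le) = inj₁ (ℕₚ.≤-trans (s≤s lt) le)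
    strictly lt (inj₂ z) = inj₂ z
    extend : ((y , _) : Strip (alt k d c) w) → Exchange c (alt k d c ++ y) → Strip (alt (suc k) c d) w
    extend (y , e , l) (p , b , q , eq , h₀) with ++-split (alt k d c) {p = p} eq
    ... | inj₁ (zs , refl , refl) = zs ++ q
        , ≈trans e (≈trans (≡⇒≈ eq) (∷-move c (≈trans (exchange-delete q h₀) (≡⇒≈ (++-assoc (alt k d c) zs q)))))
        , trans l (trans (cong (length (alt k d c) +ⁿ_) (length-delete zs b q)) (ℕₚ.+-suc (length (alt k d c)) _))
    ... | inj₂ (zs , eq′ , _) with alt-prefix k p eq′
    ...   | i , lt , refl , eq″ = ⊥-elim (alt-distinct i c d (strictly lt h) (≈trans h₀ (≡⇒≈ eq″)))

  -- With infinite order an alternating word of any length splits off; one letter more than `w` has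
  -- is already too many.
  dihedral-finite : ∀ {w} → Reduced m w → ∀ s t → ¬ Reduced m (s ∷ w) → ¬ Reduced m (t ∷ w) → m s t ≢ 0
  dihedral-finite {w} r s t ns nt z = dihedral-¬¬ r (suc (length w)) s t (inj₂ z) ns nt
    λ (y , _ , l) → ℕₚ.<-irrefl (trans l (cong (_+ⁿ length y) (length-alt (suc (length w)) s t))) (s≤s (ℕₚ.m≤m+n _ _))

  -- Deciding equality by induction on length

  private
    -- Reducedness is asked of one side only, because `exchange?` compares `s ∷ p`, about which
    -- nothing is known, with a prefix of a reduced word.
    SameLength? : ℕ → Set
    SameLength? k = ∀ u v → length u ≡ k → length v ≡ k → Reduced m v → Dec (u ≈ v)

  module Search (L : ℕ) (same? : ∀ {j} → j <ⁿ L → SameLength? j) where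
    exchange? : ∀ s r → Reduced m r → length r <ⁿ L → Dec (Exchange s r)
    exchange? s r rr lt = split? (λ p b → s ∷ p ≈ p ++ [ b ]) r λ { p b q refl →
      same? (ℕₚ.≤-trans (s≤s (prefix-≤ p b q)) lt) (s ∷ p) (p ++ [ b ]) refl (trans (length-++ p) (ℕₚ.+-comm _ 1))
        (reduced-++ˡ (p ++ [ b ]) q (subst (Reduced m) (sym (++-assoc p [ b ] q)) rr)) }
      where
      prefix-≤ : ∀ (p : Word) b q → suc (length p) ≤ⁿ length (p ++ b ∷ q)
      prefix-≤ p b q = subst (suc (length p) ≤ⁿ_) (sym (length-delete p b q))
        (s≤s (subst (length p ≤ⁿ_) (sym (length-++ p)) (ℕₚ.m≤m+n _ _)))

    strip? : ∀ cs r → Reduced m r → length r <ⁿ L → Dec (Strip cs r)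
    strip? [] r rr lt = yes (r , ≈refl r , refl)
    strip? (c ∷ cs) r rr lt with exchange? c r rr lt
    ... | no ¬x = no λ (x , e , l) →
      exchange-¬¬ rr (strip⇒¬reduced (cs ++ x , e , trans l (cong suc (sym (length-++ cs))))) ¬x
    ... | yes X = map′ to from (strip? cs r₁ (reduced-tail (strip-reduced rr (r₁ , e₁ , l₁))) (ℕₚ.≤-trans (s≤s (ℕₚ.≤-trans (ℕₚ.n≤1+n _) (ℕₚ.≤-reflexive (sym l₁)))) lt))
      where
      r₁ = proj₁ (exchange⇒strip X)
      e₁ = proj₁ (proj₂ (exchange⇒strip X))
      l₁ = proj₂ (proj₂ (exchange⇒strip X))
      to : Strip cs r₁ → Strip (c ∷ cs) r
      to (x , e , l) = x , ≈trans e₁ (∷-cong c e) , trans l₁ (cong suc l)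
      from : Strip (c ∷ cs) r → Strip cs r₁
      from (x , e , l) = x , ∷-cancel c (≈trans (≈sym e₁) e) , ℕₚ.suc-injective (trans (sym l₁) l)

  private
    -- For distinct heads, equality would make both `a` and `b` descents of the reduced word
    -- `b ∷ v`. Then `m b a` is finite and the alternating word of that length splits off, which is
    -- tested on the shorter word `v`. If it does split off, the braid relation respells `b ∷ v`
    -- with head `a`, and the tails are compared.
    sameLength-step : ∀ L → (∀ {j} → j <ⁿ L → SameLength? j) → SameLength? L
    sameLength-step .0 same? [] [] refl _ _ = yes (≈refl [])
    sameLength-step .(suc (length u)) same? (a ∷ u) (b ∷ v) refl lv rv with a ≟ᶠ b
    ... | yes refl = map′ (∷-cong a) (∷-cancel a) (same? ℕₚ.≤-refl u v refl (ℕₚ.suc-injective lv) (reduced-tail rv))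
    ... | no a≢b = go (m b a) refl
      where
      open Search (suc (length u)) same?
      descents : a ∷ u ≈ b ∷ v → (¬ Reduced m (b ∷ b ∷ v)) × (¬ Reduced m (a ∷ b ∷ v))
      descents e = strip⇒¬reduced (v , ≈refl _ , refl) , strip⇒¬reduced (u , ≈sym e , lv)
      go : ∀ M → m b a ≡ M → Dec (a ∷ u ≈ b ∷ v)
      go zero z = no λ e → dihedral-finite rv b a (proj₁ (descents e)) (proj₂ (descents e)) z
      go (suc M) eq with strip? (alt M a b) v (reduced-tail rv) (ℕₚ.≤-reflexive lv)
      ... | no ¬S = no λ e → dihedral-¬¬ rv (suc M) b a (inj₁ (ℕₚ.≤-reflexive (sym eq))) (proj₁ (descents e)) (proj₂ (descents e))
              λ (y , e′ , l) → ¬S (y , ∷-cancel b e′ , ℕₚ.suc-injective l)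
      ... | yes (x , e , l) = map′ (λ h → ≈trans (∷-cong a h) (≈sym other)) (λ h → ∷-cancel a (≈trans h other))
              (same? ℕₚ.≤-refl u (alt M b a ++ x) refl lx
                (reduced-tail {a} (reduced-resp rv (≈sym other) (ℕₚ.≤-reflexive (trans (cong suc lx) (sym lv))))))
        where
        lx : length (alt M b a ++ x) ≡ length u
        lx = trans (length-++ (alt M b a)) (trans (cong (_+ⁿ length x) (trans (length-alt M b a) (sym (length-alt M a b))))
               (trans (sym l) (ℕₚ.suc-injective lv)))
        other : b ∷ v ≈ a ∷ alt M b a ++ x
        other = ≈trans (∷-cong b e) (++-congʳ x
          (subst (λ k → alt k b a ≈ alt k a b) eq (braid b a (λ z → case trans (sym z) eq of λ ()))))

    same? : ∀ L → SameLength? L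
    same? = <-rec SameLength? sameLength-step

  exchange? : ∀ s r → Reduced m r → Dec (Exchange s r)
  exchange? s r rr = Search.exchange? (suc (length r)) (λ {j} _ → same? j) s r rr ℕₚ.≤-refl

  strip? : ∀ cs r → Reduced m r → Dec (Strip cs r)
  strip? cs r rr = Search.strip? (suc (length r)) (λ {j} _ → same? j) cs r rr ℕₚ.≤-refl

  -- Once the prefix equations can be decided, the double negation in `exchange-¬¬` disappears.
  exchange : ∀ {s u} → Reduced m u → ¬ Reduced m (s ∷ u) → Exchange s u
  exchange {s} {u} r nr = decidable-stable (exchange? s u r) (exchange-¬¬ r nr)

  ¬exchange⇒reduced : ∀ {s u} → Reduced m u → ¬ Exchange s u → Reduced m (s ∷ u)
  ¬exchange⇒reduced r nx = reduced-stable λ nr → exchange-¬¬ r nr nx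

  -- Deletion property. The subword clause turns any subword witness into a reduced one, as `Bruhat`
  -- demands.
  reduced-subword : ∀ u → ∃[ r ] (r ≈ u × Reduced m r × r ⊆ u)
  reduced-subword [] = [] , ≈refl [] , (λ _ _ → z≤n) , []
  reduced-subword (s ∷ u) with reduced-subword u
  ... | r , e , rr , sub with exchange? s r rr
  ...   | no ¬x = s ∷ r , ∷-cong s e , ¬exchange⇒reduced rr ¬x , refl ∷ sub
  ...   | yes X@(p , b , q , refl , h) = p ++ q , ≈trans (≈sym (exchange-delete q h)) (∷-cong s e)
          , reduced-tail (strip-reduced rr (exchange⇒strip X)) , s ∷ʳ ⊆-trans (⊆-delete p) sub

  normal : Word → Word
  normal u = proj₁ (reduced-subword u)

  normal-≈ : ∀ u → normal u ≈ u
  normal-≈ u = proj₁ (proj₂ (reduced-subword u))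

  normal-reduced : ∀ u → Reduced m (normal u)
  normal-reduced u = proj₁ (proj₂ (proj₂ (reduced-subword u)))

  normal-⊆ : ∀ u → normal u ⊆ u
  normal-⊆ u = proj₂ (proj₂ (proj₂ (reduced-subword u)))

  infix 4 _≈?_
  _≈?_ : ∀ u v → Dec (u ≈ v)
  u ≈? v with length (normal u) ≟ⁿ length (normal v)
  ... | no ne = no λ e → ne (reduced-length (normal-reduced u) (normal-reduced v)
          (≈trans (normal-≈ u) (≈trans e (≈sym (normal-≈ v)))))
  ... | yes eq = map′ (λ e → ≈trans (≈sym (normal-≈ u)) (≈trans e (normal-≈ v)))
          (λ e → ≈trans (normal-≈ u) (≈trans e (≈sym (normal-≈ v))))
          (same? _ (normal u) (normal v) eq refl (normal-reduced v))

  Descent : Fin n → Word → Set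
  Descent s w = ∃[ x ] (w ≈ s ∷ x × Reduced m (s ∷ x))

  descent-resp : ∀ {s u v} → u ≈ v → Descent s u → Descent s v
  descent-resp e (x , f , r) = x , ≈trans (≈sym e) f , r

  descent⇒¬reduced : ∀ {s u} → Descent s u → ¬ Reduced m (s ∷ u)
  descent⇒¬reduced {s} {u} (x , e , r) r′ = ℕₚ.<-irrefl refl
    (ℕₚ.≤-trans (ℕₚ.≤-trans (s≤s (r u e)) (r′ x (≈sym (≈trans (∷-cong s e) (∷-square s x))))) (ℕₚ.n≤1+n _))

  strip⇒descent : ∀ {s u} → Reduced m u → Strip [ s ] u → Descent s u
  strip⇒descent r S = proj₁ S , proj₁ (proj₂ S) , strip-reduced r S

  descent? : ∀ s w → Dec (Descent s w)
  descent? s w with exchange? s (normal w) (normal-reduced w)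
  ... | yes X = yes (descent-resp (normal-≈ w) (strip⇒descent (normal-reduced w) (exchange⇒strip X)))
  ... | no ¬x = no λ D → descent⇒¬reduced (descent-resp (≈sym (normal-≈ w)) D) (¬exchange⇒reduced (normal-reduced w) ¬x)

  ¬descent⇒reduced : ∀ {s u} → Reduced m u → ¬ Descent s u → Reduced m (s ∷ u)
  ¬descent⇒reduced r nd = ¬exchange⇒reduced r λ X → nd (strip⇒descent r (exchange⇒strip X))

  abstract
    dihedral : ∀ {s t w} → Descent s w → Descent t w →
      m s t ≢ 0 × ∃[ y ] (w ≈ alt (m s t) s t ++ y × Reduced m (alt (m s t) s t ++ y))
    dihedral {s} {t} {w} Ds Dt = dihedral-finite nr s t ns nt , proj₁ S
      , ≈trans (≈sym (normal-≈ w)) (proj₁ (proj₂ S)) , strip-reduced nr S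
      where
      nr : Reduced m (normal w)
      nr = normal-reduced w
      ns : ¬ Reduced m (s ∷ normal w)
      ns = descent⇒¬reduced (descent-resp (≈sym (normal-≈ w)) Ds)
      nt : ¬ Reduced m (t ∷ normal w)
      nt = descent⇒¬reduced (descent-resp (≈sym (normal-≈ w)) Dt)
      S : Strip (alt (m s t) s t) (normal w)
      S = decidable-stable (strip? _ _ nr) (dihedral-¬¬ nr (m s t) s t (inj₁ ℕₚ.≤-refl) ns nt)

-- Dihedral parabolic subgroups and subwords

Pair : ∀ {n} (s t c d : Fin n) → Set
Pair s t c d = (c ≡ s × d ≡ t) ⊎ (c ≡ t × d ≡ s)

pair-swap : ∀ {n} {s t c d : Fin n} → Pair s t c d → Pair s t d c
pair-swap (inj₁ (e , f)) = inj₂ (f , e)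
pair-swap (inj₂ (e , f)) = inj₁ (f , e)

module Dihedral {n : ℕ} (m : CoxMat n) (cox : IsCoxeterMatrix m) where
  open Coxeter m cox public

  m-pair : ∀ {s t c d} → Pair s t c d → m c d ≡ m s t
  m-pair (inj₁ (refl , refl)) = refl
  m-pair (inj₂ (refl , refl)) = m-sym _ _

  ¬descent-[] : ∀ {s} → ¬ Descent s []
  ¬descent-[] (x , e , r) with r [] e
  ... | ()

  reduced-[] : Reduced m []
  reduced-[] _ _ = z≤n

  -- `r` is the shortest element of its coset of the dihedral subgroup, so lengths add. With `r`
  -- empty this gives `alt-reduced`.
  alt-++-reduced : ∀ {s t r} → Reduced m r → ¬ Descent s r → ¬ Descent t r →
    ∀ k {c d} → Pair s t c d → k ≤∞ m s t → Reduced m (alt k c d ++ r)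
  alt-++-reduced rr ns nt zero _ _ = rr
  alt-++-reduced {s} {t} {r} rr ns nt (suc k) {c} {d} cd h = ¬descent⇒reduced ih (contra k h ih)
    where
    ih : Reduced m (alt k d c ++ r)
    ih = alt-++-reduced rr ns nt k (pair-swap cd) (≤∞-pred h)
    ¬descent : ∀ {e f} → Pair s t e f → ¬ Descent e r
    ¬descent (inj₁ (refl , _)) = ns
    ¬descent (inj₂ (refl , _)) = nt
    trailing : ∀ k y l {e f} → Pair s t e f → Reduced m ((alt k d c ++ alt (suc l) e f) ++ y) →
               alt k d c ++ r ≈ (alt k d c ++ alt (suc l) e f) ++ y → ⊥
    trailing k y l {e} {f} ef red eq = ¬descent ef
      ( _ , ++-cancelˡ (alt k d c) r _ (≈trans eq (≡⇒≈ (++-assoc (alt k d c) (alt (suc l) e f) y)))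
      , reduced-++ʳ (alt k d c) _ (subst (Reduced m) (++-assoc (alt k d c) (alt (suc l) e f) y) red))
    pair-trans : ∀ {e f} → Pair d c e f → Pair s t e f
    pair-trans (inj₁ (refl , refl)) = pair-swap cd
    pair-trans (inj₂ (refl , refl)) = cd
    -- otherwise a longest element splits off, and what follows alt k d c in it is a descent of r
    contra : ∀ k → suc k ≤∞ m s t → Reduced m (alt k d c ++ r) → ¬ Descent c (alt k d c ++ r)
    contra zero _ _ D = ¬descent cd D
    contra (suc k) h ih D with dihedral (_ , ≈refl _ , ih) D
    ... | M≢0 , y , eq , red = split (m d c) refl (bound h)
      where
      bound : suc (suc k) ≤∞ m s t → suc (suc k) ≤ⁿ m d c
      bound (inj₁ le) = subst (suc (suc k) ≤ⁿ_) (sym (m-pair (pair-swap cd))) le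
      bound (inj₂ z) = ⊥-elim (M≢0 (trans (m-pair (pair-swap cd)) z))
      split : ∀ M → M ≡ m d c → suc (suc k) ≤ⁿ M → ⊥
      split M eM le with M ∸ suc (suc k) | ℕₚ.m+[n∸m]≡n le
      -- Since `k + 2 ≤ m d c`, at least one letter, here `suc l` of them, remains after
      -- `alt (suc k) d c`.
      ... | l | refl with alt-+ (suc k) (suc l) d c
      ...   | e , f , ef , eq′ = trailing (suc k) y l (pair-trans ef) (subst (λ w → Reduced m (w ++ y)) altM red)
                (≈trans eq (≡⇒≈ (cong (_++ y) altM)))
        where
        altM : alt (m d c) d c ≡ alt (suc k) d c ++ alt (suc l) e f
        altM = trans (cong (λ j → alt j d c) (trans (sym eM) (sym (ℕₚ.+-suc (suc k) l)))) eq′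

  alt-reduced : ∀ k s t → k ≤∞ m s t → Reduced m (alt k s t)
  alt-reduced k s t h = subst (Reduced m) (++-identityʳ _)
    (alt-++-reduced {s} {t} reduced-[] ¬descent-[] ¬descent-[] k (inj₁ (refl , refl)) h)

  dihedral-normal : ∀ {s t} → m s t ≢ 0 → ∀ {w} → All (λ a → a ≡ s ⊎ a ≡ t) w →
    ∃[ i ] ∃[ c ] ∃[ d ] (i ≤ⁿ m s t × Pair s t c d × w ≈ alt i c d)
  dihedral-normal {s} {t} M≢0 [] = 0 , s , t , z≤n , inj₁ (refl , refl) , ≈refl []
  dihedral-normal {s} {t} M≢0 {a ∷ w} (a∈ ∷ w∈) with dihedral-normal M≢0 w∈
  ... | i , c , d , le , cd , e = go i (letter a∈ cd) le e
    where
    letter : ∀ {a c d} → a ≡ s ⊎ a ≡ t → Pair s t c d → a ≡ c ⊎ a ≡ d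
    letter (inj₁ refl) (inj₁ (refl , refl)) = inj₁ refl
    letter (inj₁ refl) (inj₂ (refl , refl)) = inj₂ refl
    letter (inj₂ refl) (inj₁ (refl , refl)) = inj₂ refl
    letter (inj₂ refl) (inj₂ (refl , refl)) = inj₁ refl
    Result : Word → Set
    Result v = ∃[ i ] ∃[ c ] ∃[ d ] (i ≤ⁿ m s t × Pair s t c d × v ≈ alt i c d)
    go : ∀ i → a ≡ c ⊎ a ≡ d → i ≤ⁿ m s t → w ≈ alt i c d → Result (a ∷ w)
    go zero (inj₁ refl) _ e = 1 , c , d , ℕₚ.n≢0⇒n>0 M≢0 , cd , ∷-cong a e
    go (suc i) (inj₁ refl) le e = i , d , c , ℕₚ.≤-trans (ℕₚ.n≤1+n i) le , pair-swap cd
      , ≈trans (∷-cong a e) (∷-square a _)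
    go i (inj₂ refl) le e with ℕₚ.m≤n⇒m<n∨m≡n le
    ... | inj₁ lt = suc i , d , c , lt , pair-swap cd , ∷-cong a e
    -- At full length the braid relation offers the spelling that begins with `a`, and the two
    -- letters `a` cancel.
    ... | inj₂ refl = full (m s t) refl
      where
      e′ : w ≈ alt (m s t) d c
      e′ = ≈trans e (subst (λ k → alt k c d ≈ alt k d c) (m-pair cd) (braid c d (λ z → M≢0 (trans (sym (m-pair cd)) z))))
      full : ∀ M → M ≡ m s t → Result (a ∷ w)
      full zero z = ⊥-elim (M≢0 (sym z))
      full (suc M) eq = M , c , d , ℕₚ.≤-trans (ℕₚ.n≤1+n M) (ℕₚ.≤-reflexive eq) , cd
        , ≈trans (∷-cong a (≈trans e′ (≡⇒≈ (cong (λ k → alt k d c) (sym eq))))) (∷-square a _)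

  -- Elements represented by subwords, and the lifting property

  infix 4 _≼_
  -- The subword may be unreduced, which makes it easy to compose; `≼-reduced` restores reducedness.
  _≼_ : Word → Word → Set
  x ≼ w = ∃[ z ] (z ⊆ w × z ≈ x)

  ≼-resp : ∀ {x y w} → x ≈ y → x ≼ w → y ≼ w
  ≼-resp e (z , sub , f) = z , sub , ≈trans f e

  ≼-reduced : ∀ {x w} → x ≼ w → ∃[ z ] (z ⊆ w × z ≈ x × Reduced m z)
  ≼-reduced (z , sub , e) = normal z , ⊆-trans (normal-⊆ z) sub , ≈trans (normal-≈ z) e , normal-reduced z

  -- Each of the two spellings of the longest element contains the whole dihedral group, so a braid
  -- move inside a word loses no element.
  dihedral-≼ : ∀ {s t w} → m s t ≢ 0 → All (λ a → a ≡ s ⊎ a ≡ t) w → w ≼ alt (m s t) t s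
  dihedral-≼ {s} {t} M≢0 w∈ with dihedral-normal M≢0 w∈
  ... | i , _ , _ , le , inj₂ (refl , refl) , e = alt i t s , alt-⊆ t s le , ≈sym e
  ... | i , _ , _ , le , inj₁ (refl , refl) , e with ℕₚ.m≤n⇒m<n∨m≡n le
  ...   | inj₁ lt = alt i s t , skip (m s t) lt , ≈sym e
    where
    skip : ∀ M → suc i ≤ⁿ M → alt i s t ⊆ alt M t s
    skip (suc M) (s≤s le) = t ∷ʳ alt-⊆ s t le
  ...   | inj₂ refl = alt (m s t) t s , ⊆-refl , ≈sym (≈trans e (braid s t M≢0))

  SubwordTransfer : ℕ → Set
  SubwordTransfer k = ∀ u v → length u ≡ k → Reduced m u → Reduced m v → u ≈ v → ∀ {x} → x ≼ u → x ≼ v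

  cons-≼ : ∀ {k s u v} → SubwordTransfer k → length u ≡ k → Reduced m (s ∷ u) → Reduced m (s ∷ v) → s ∷ u ≈ s ∷ v →
    ∀ {x} → x ≼ (s ∷ u) → x ≼ (s ∷ v)
  cons-≼ {s = s} {u} {v} ih l ru rv e (z , _ ∷ʳ sub , f)
    with ih u v l (reduced-tail ru) (reduced-tail rv) (∷-cancel s e) (z , sub , ≈refl z)
  ... | z′ , sub′ , f′ = z′ , s ∷ʳ sub′ , ≈trans f′ f
  cons-≼ {s = s} {u} {v} ih l ru rv e (_ ∷ z , refl ∷ sub , f)
    with ih u v l (reduced-tail ru) (reduced-tail rv) (∷-cancel s e) (z , sub , ≈refl z)
  ... | z′ , sub′ , f′ = s ∷ z′ , refl ∷ sub′ , ≈trans (∷-cong s f′) f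

  braid-≼ : ∀ s t y → m s t ≢ 0 → ∀ {x} → x ≼ (alt (m s t) s t ++ y) → x ≼ (alt (m s t) t s ++ y)
  braid-≼ s t y M≢0 (z , sub , f) with ⊆-++⁻ (alt (m s t) s t) sub
  ... | a , b , refl , sub₁ , sub₂ with dihedral-≼ {s} {t} M≢0 (Subₚ.All-resp-⊆ sub₁ (alt-letters (m s t) (inj₁ refl) (inj₂ refl)))
  ...   | a′ , sub₁′ , f′ = a′ ++ b , Subₚ.++⁺ sub₁′ sub₂ , ≈trans (++-congʳ b f′) f

  -- The chain `s ∷ u`, `alt (m s t) s t ++ y`, `alt (m s t) t s ++ y`, `t ∷ v` consists of reduced
  -- words of one element. Its outer links share the first letter and reduce to shorter words; its
  -- middle link is a braid move. Equal heads are covered too, with `m s s = 1`.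
  ≼-transfer : ∀ k → SubwordTransfer k
  ≼-transfer _ [] [] _ _ _ _ x≼ = x≼
  ≼-transfer _ [] (t ∷ v) _ ru rv e _ with rv [] e
  ... | ()
  ≼-transfer _ (s ∷ u) [] _ ru rv e _ with ru [] (≈sym e)
  ... | ()
  ≼-transfer (suc k) (s ∷ u) (t ∷ v) l ru rv e {x} x≼
    with dihedral {s} {t} {s ∷ u} (u , ≈refl _ , ru) (v , e , rv)
  ... | M≢0 , y , e₁ , r₁ = go (m s t) refl
    where
    len : length (alt (m s t) s t ++ y) ≡ suc k
    len = trans (reduced-length r₁ ru (≈sym e₁)) l
    e₂ : alt (m s t) s t ++ y ≈ alt (m s t) t s ++ y
    e₂ = ++-congʳ y (braid s t M≢0)
    lengths : length (alt (m s t) t s ++ y) ≡ length (alt (m s t) s t ++ y)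
    lengths = trans (length-++ (alt (m s t) t s)) (trans (cong (_+ⁿ length y) (trans (length-alt (m s t) t s) (sym (length-alt (m s t) s t)))) (sym (length-++ (alt (m s t) s t))))
    r₂ : Reduced m (alt (m s t) t s ++ y)
    r₂ = reduced-resp r₁ (≈sym e₂) (ℕₚ.≤-reflexive lengths)
    go : ∀ M → m s t ≡ M → x ≼ (t ∷ v)
    go zero z = ⊥-elim (M≢0 z)
    go (suc M) eq = cons-≼ (≼-transfer k) (ℕₚ.suc-injective (trans (cong (λ j → length (alt j t s ++ y)) (sym eq)) (trans lengths len))) r₂′ rv
      (≈trans (≈trans (≡⇒≈ (cong (λ j → alt j t s ++ y) (sym eq))) (≈sym (≈trans e₁ e₂))) e)
      (subst (λ j → x ≼ (alt j t s ++ y)) eq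
        (braid-≼ s t y M≢0
          (subst (λ j → x ≼ (alt j s t ++ y)) (sym eq)
            (cons-≼ (≼-transfer k) (ℕₚ.suc-injective l) ru (subst (λ j → Reduced m (alt j s t ++ y)) eq r₁)
              (≈trans e₁ (≡⇒≈ (cong (λ j → alt j s t ++ y) eq))) x≼))))
      where
      r₂′ : Reduced m (t ∷ alt M s t ++ y)
      r₂′ = subst (λ j → Reduced m (alt j t s ++ y)) eq r₂

  -- A reduced subword for `c ∷ cs ++ y` either uses the first letter `c`, which cancels, or avoids
  -- it. In the second case `c` is a descent, and the exchange property deletes a letter from the
  -- subword instead.
  lift-down : ∀ cs {y w} → Reduced m (cs ++ y) → (cs ++ y) ≼ (cs ++ w) → y ≼ w
  lift-down [] r h = h
  lift-down (c ∷ cs) {y} {w} r h with ≼-reduced h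
  ... | z , sub , e , rz = lift-down cs (reduced-tail r) (step sub e rz)
    where
    step : ∀ {z} → z ⊆ c ∷ cs ++ w → z ≈ c ∷ cs ++ y → Reduced m z → (cs ++ y) ≼ (cs ++ w)
    step {_ ∷ z} (refl ∷ sub) e rz = z , sub , ∷-cancel c e
    step {z} (_ ∷ʳ sub) e rz with exchange rz (descent⇒¬reduced (_ , e , r))
    ... | p , b , q , refl , f = p ++ q , ⊆-trans (⊆-delete p) sub
        , ≈trans (≈sym (exchange-delete q f)) (≈trans (∷-cong c e) (∷-square c _))

  -- A reduced subword that used the first letter would make that letter a descent of `x`.
  lift-up : ∀ cs {x w} → All (λ c → ¬ Descent c x) cs → x ≼ (cs ++ w) → x ≼ w
  lift-up [] [] h = h
  lift-up (c ∷ cs) {x} {w} (nc ∷ ncs) h with ≼-reduced h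
  ... | z , sub , e , rz = lift-up cs ncs (step sub e rz)
    where
    step : ∀ {z} → z ⊆ c ∷ cs ++ w → z ≈ x → Reduced m z → x ≼ (cs ++ w)
    step {_ ∷ z} (refl ∷ sub) e rz = ⊥-elim (nc (z , ≈sym e , rz))
    step {z} (_ ∷ʳ sub) e rz = z , sub , e

-- Folding

concatMap-split : ∀ {A B : Set} (f : A → List B) u {p b q} → concatMap f u ≡ p ++ b ∷ q →
  ∃[ u₁ ] ∃[ j ] ∃[ u₂ ] ∃[ p′ ] ∃[ q′ ] (u ≡ u₁ ++ j ∷ u₂ × f j ≡ p′ ++ b ∷ q′ × p ≡ concatMap f u₁ ++ p′)
concatMap-split f [] {[]} ()
concatMap-split f [] {_ ∷ _} ()
concatMap-split f (i ∷ u) {p} e with ++-split (f i) {p = p} e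
... | inj₂ (zs , e′ , _) = [] , i , u , p , zs , refl , e′ , refl
... | inj₁ (zs , refl , e′) with concatMap-split f u e′
...   | u₁ , j , u₂ , p′ , q′ , refl , e″ , refl = i ∷ u₁ , j , u₂ , p′ , q′ , refl , e″ , sym (++-assoc (f i) _ p′)

concatMap-⊆ : ∀ {A B : Set} (f : A → List B) {u v} → u ⊆ v → concatMap f u ⊆ concatMap f v
concatMap-⊆ f [] = []
concatMap-⊆ f (y ∷ʳ h) = Subₚ.++⁺ˡ (f y) (concatMap-⊆ f h)
concatMap-⊆ f (refl ∷ h) = Subₚ.++⁺ ⊆-refl (concatMap-⊆ f h)

module Folding {n : ℕ} (m : CoxMat n) (cox : IsCoxeterMatrix m)
  (φ : List (Fin n) → List (Fin n)) (aut : IsInvolutiveSAut m φ) (Wt : FoldedSystem m φ) where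

  open IsInvolutiveSAut aut
  open FoldedSystem Wt
  open Dihedral m cox
  module W̃ = Dihedral m̃ m̃-cox

  σ : Fin n → Fin n
  σ s = proj₁ (gen s)

  idempotent⇒ε : ∀ {u} → u ≈ u ++ u → u ≈ []
  idempotent⇒ε {u} e = ++-cancelˡ u u [] (≈trans (≈sym e) (≡⇒≈ (sym (++-identityʳ u))))

  φ≈map-σ : ∀ w → φ w ≈ map σ w
  φ≈map-σ [] = idempotent⇒ε (hom [] [])
  φ≈map-σ (s ∷ w) = ≈trans (hom [ s ] w) (++-cong (proj₂ (gen s)) (φ≈map-σ w))

  map-σ-cong : ∀ {u v} → u ≈ v → map σ u ≈ map σ v
  map-σ-cong {u} {v} e = ≈trans (≈sym (φ≈map-σ u)) (≈trans (resp u v e) (φ≈map-σ v))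

  -- The automorphism squares to the identity only in W; `generator-injective` makes this an
  -- identity of letters.
  σ-involutive : ∀ s → σ (σ s) ≡ s
  σ-involutive s = generator-injective (≈trans (≈sym (proj₂ (gen (σ s))))
    (≈trans (resp _ _ (≈sym (proj₂ (gen s)))) (invol [ s ])))

  map-σ-involutive : ∀ w → map σ (map σ w) ≡ w
  map-σ-involutive [] = refl
  map-σ-involutive (s ∷ w) = cong₂ _∷_ (σ-involutive s) (map-σ-involutive w)

  map-σ-reduced : ∀ {u} → Reduced m u → Reduced m (map σ u)
  map-σ-reduced {u} r v e = subst₂ _≤ⁿ_ (sym (length-map σ u)) (length-map σ v)
    (r (map σ v) (≈trans (map-σ-cong e) (≡⇒≈ (map-σ-involutive u))))

  map-σ-descent : ∀ {s w} → Descent s w → Descent (σ s) (map σ w)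
  map-σ-descent {s} (x , e , r) = map σ x , map-σ-cong e , map-σ-reduced r

  fixed⇒map-σ : ∀ {w} → Fixed m φ w → map σ w ≈ w
  fixed⇒map-σ {w} e = ≈trans (≈sym (φ≈map-σ w)) e

  orbit⇒ : ∀ {s t} → InOrb m φ s t → t ≡ s ⊎ t ≡ σ s
  orbit⇒ (inj₁ e) = inj₁ e
  orbit⇒ {s} (inj₂ e) = inj₂ (sym (generator-injective (≈trans (≈sym (proj₂ (gen s))) e)))

  ⇒orbit : ∀ {s t} → t ≡ s ⊎ t ≡ σ s → InOrb m φ s t
  ⇒orbit (inj₁ e) = inj₁ e
  ⇒orbit {s} (inj₂ refl) = inj₂ (proj₂ (gen s))

  map-σ-alt : ∀ k s → map σ (alt k s (σ s)) ≡ alt k (σ s) s × map σ (alt k (σ s) s) ≡ alt k s (σ s)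
  map-σ-alt zero s = refl , refl
  map-σ-alt (suc k) s = cong (σ s ∷_) (proj₂ (map-σ-alt k s)) , cong₂ _∷_ (σ-involutive s) (proj₁ (map-σ-alt k s))

  -- A letter fixed by `σ` has order `m s s = 1`, so its block is the letter itself and one-element
  -- orbits need no separate treatment.
  order : Fin k → ℕ
  order i = m (rep i) (σ (rep i))

  -- the longest element of the parabolic subgroup of the i-th orbit
  ω : Fin k → Word
  ω i = alt (order i) (rep i) (σ (rep i))

  -- With infinite order the alternating word of length `suc N` would be reduced, against the bound
  -- `N` on the parabolic subgroup.
  order≢0 : ∀ i → order i ≢ 0
  order≢0 i z with rep-fin i
  ... | N , bounded with bounded (alt (suc N) (rep i) (σ (rep i))) (alt-letters (suc N) (⇒orbit (inj₁ refl)) (⇒orbit (inj₂ refl)))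
  ...   | w , _ , e , le = ℕₚ.<-irrefl refl (ℕₚ.≤-trans
            (subst (_≤ⁿ length w) (length-alt (suc N) (rep i) (σ (rep i))) (alt-reduced (suc N) _ _ (inj₂ z) w e)) le)

  ω-reduced : ∀ i → Reduced m (ω i)
  ω-reduced i = alt-reduced _ _ _ (inj₁ ℕₚ.≤-refl)

  -- The longest element is given only by its length. It has an alternating spelling of length at
  -- most `order i`, comparison with `ω i` forces equality, and the braid relation identifies the
  -- two spellings of that length.
  ψ-generator : ∀ i → ψ [ i ] ≈ ω i
  ψ-generator i with rep-w0 i
  ... | (x , x∈ , e) , longest with dihedral-normal (order≢0 i) (All.map orbit⇒ x∈)
  ...   | j , c , d , le , cd , e′ = full (ℕₚ.≤-antisym le maximal) cd e′
    where
    reduced-cd : ∀ {c d} → Pair (rep i) (σ (rep i)) c d → Reduced m (alt j c d)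
    reduced-cd cd = alt-reduced j _ _ (inj₁ (subst (j ≤ⁿ_) (sym (m-pair cd)) le))
    maximal : order i ≤ⁿ j
    maximal = longest (ω i) (alt-letters (order i) (⇒orbit (inj₁ refl)) (⇒orbit (inj₂ refl))) (order i) j
      (ω i , ≈refl _ , ω-reduced i , length-alt (order i) _ _)
      (alt j c d , ≈trans (≈sym e′) e , reduced-cd cd , length-alt j c d)
    full : j ≡ order i → Pair (rep i) (σ (rep i)) c d → x ≈ alt j c d → ψ [ i ] ≈ ω i
    full refl (inj₁ (refl , refl)) e′ = ≈trans (≈sym e) e′
    full refl (inj₂ (refl , refl)) e′ = ≈trans (≈sym e) (≈trans e′ (≈sym (braid _ _ (order≢0 i))))

  ω* : List (Fin k) → Word
  ω* = concatMap ω

  ψ-[] : ψ [] ≈ []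
  ψ-[] = idempotent⇒ε (ψ-hom [] [])

  ψ-∷ : ∀ i u → ψ (i ∷ u) ≈ ω i ++ ψ u
  ψ-∷ i u = ≈trans (ψ-hom [ i ] u) (++-congʳ (ψ u) (ψ-generator i))

  ω*≈ψ : ∀ u → ω* u ≈ ψ u
  ω*≈ψ [] = ≈sym ψ-[]
  ω*≈ψ (i ∷ u) = ≈trans (++-congˡ (ω i) (ω*≈ψ u)) (≈sym (ψ-∷ i u))

  ψ-fixed : ∀ u → map σ (ψ u) ≈ ψ u
  ψ-fixed u = fixed⇒map-σ (ψ-fix u)

  ω*-fixed : ∀ u → map σ (ω* u) ≈ ω* u
  ω*-fixed u = ≈trans (map-σ-cong (ω*≈ψ u)) (≈trans (ψ-fixed u) (≈sym (ω*≈ψ u)))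

  ω-fixed : ∀ i → map σ (ω i) ≈ ω i
  ω-fixed i = ≈trans (map-σ-cong (≈sym (ψ-generator i))) (≈trans (ψ-fixed [ i ]) (ψ-generator i))

  fixed-descent : ∀ {s w} → map σ w ≈ w → Descent s w → Descent (σ s) w
  fixed-descent e D = descent-resp e (map-σ-descent D)

  fixed-¬descent : ∀ {s w} → map σ w ≈ w → ¬ Descent s w → ¬ Descent (σ s) w
  fixed-¬descent {s} e nD D = nD (subst (λ t → Descent t _) (σ-involutive s) (fixed-descent e D))

  -- `σ` swaps the two alternating words of each length, and these differ in W at every positive
  -- length below the order.
  fixed-dihedral : ∀ j {z} → All (λ a → a ≡ rep j ⊎ a ≡ σ (rep j)) z → map σ z ≈ z → ¬ z ≈ [] → z ≈ ω j
  fixed-dihedral j {z} z∈ fixed z≉[] with dihedral-normal (order≢0 j) z∈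
  ... | i , c , d , le , cd , e = go i le e (swapped cd i)
    where
    swapped : ∀ {c d} → Pair (rep j) (σ (rep j)) c d → ∀ i → map σ (alt i c d) ≡ alt i d c
    swapped (inj₁ (refl , refl)) i = proj₁ (map-σ-alt i (rep j))
    swapped (inj₂ (refl , refl)) i = proj₂ (map-σ-alt i (rep j))
    whole : ∀ {c d} → Pair (rep j) (σ (rep j)) c d → alt (order j) c d ≈ ω j
    whole (inj₁ (refl , refl)) = ≈refl _
    whole (inj₂ (refl , refl)) = ≈sym (braid _ _ (order≢0 j))
    go : ∀ i → i ≤ⁿ order j → z ≈ alt i c d → map σ (alt i c d) ≡ alt i d c → z ≈ ω j
    go zero _ e _ = ⊥-elim (z≉[] e)
    go (suc i) le e sw with ℕₚ.m≤n⇒m<n∨m≡n le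
    ... | inj₁ lt = ⊥-elim (alt-distinct i c d (inj₁ (subst (suc i <ⁿ_) (sym (m-pair cd)) lt))
                      (≈trans (≈sym e) (≈trans (≈sym fixed) (≈trans (map-σ-cong e) (≡⇒≈ sw)))))
    ... | inj₂ eq = ≈trans e (≈trans (≡⇒≈ (cong (λ l → alt l c d) eq)) (whole cd))

  Letters : Fin k → Word → Set
  Letters j = All (λ a → a ≡ rep j ⊎ a ≡ σ (rep j))

  inv-letters : ∀ {P : Fin n → Set} {u} → All P u → All P (inv u)
  inv-letters [] = []
  inv-letters (p ∷ ps) = Allₚ.++⁺ (inv-letters ps) (p ∷ [])

  -- Applying `σ` to the equation for `s` gives the one for `σ s`, because `x` is fixed; the
  -- equations then multiply over the letters of `z`.
  commute-past : ∀ {j x s} → (∃[ y ] (Letters j y × s ∷ x ≈ x ++ y)) → map σ x ≈ x →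
    ∀ z → All (λ a → a ≡ s ⊎ a ≡ σ s) z → ∃[ y ] (Letters j y × z ++ x ≈ x ++ y)
  commute-past {j} {x} {s} (y , y∈ , e) fixed = go
    where
    σ-letter : ∀ {a} → a ≡ rep j ⊎ a ≡ σ (rep j) → σ a ≡ rep j ⊎ σ a ≡ σ (rep j)
    σ-letter (inj₁ refl) = inj₂ refl
    σ-letter (inj₂ refl) = inj₁ (σ-involutive _)
    letter : ∀ {a} → a ≡ s ⊎ a ≡ σ s → ∃[ y ] (Letters j y × a ∷ x ≈ x ++ y)
    letter (inj₁ refl) = y , y∈ , e
    letter (inj₂ refl) = map σ y , Allₚ.map⁺ (All.map σ-letter y∈)
      , ≈trans (∷-cong (σ s) (≈sym fixed)) (≈trans (map-σ-cong e) (≈trans (≡⇒≈ (map-++ σ x y)) (++-congʳ (map σ y) fixed)))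
    go : ∀ z → All (λ a → a ≡ s ⊎ a ≡ σ s) z → ∃[ y ] (Letters j y × z ++ x ≈ x ++ y)
    go [] [] = [] , [] , ≡⇒≈ (sym (++-identityʳ x))
    go (a ∷ z) (a∈ ∷ z∈) with letter a∈ | go z z∈
    ... | y₁ , y₁∈ , e₁ | y₂ , y₂∈ , e₂ = y₁ ++ y₂ , Allₚ.++⁺ y₁∈ y₂∈
      , ≈trans (∷-cong a e₂) (≈trans (++-congʳ y₂ e₁) (≡⇒≈ (++-assoc x y₁ y₂)))

  -- A descent of ω* u exchanges a letter of some block ω j; being fixed by σ,
  -- the conjugate of ω i by the preceding blocks is the whole of ω j.
  folded-exchange : ∀ i u → Reduced m (ω* u) → Descent (rep i) (ω* u) → W̃.Exchange i u
  folded-exchange i u r D with exchange r (descent⇒¬reduced D)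
  ... | P , b , Q , eq , h with concatMap-split ω u eq
  ...   | p , j , q , p′ , q′ , refl , eqⱼ , refl = p , j , q , refl , ψ-inj _ _ (begin
      ψ (i ∷ p)                  ≈⟨ ψ-∷ i p ⟩
      ω i ++ ψ p                 ≈⟨ ++-congˡ (ω i) (≈sym (ω*≈ψ p)) ⟩
      ω i ++ x                   ≈⟨ past ⟩
      x ++ z                     ≈⟨ ++-cong (ω*≈ψ p) (fixed-dihedral j z∈ z-fixed z≉[]) ⟩
      ψ p ++ ω j                 ≈⟨ ++-congˡ (ψ p) (≈sym (ψ-generator j)) ⟩
      ψ p ++ ψ [ j ]             ≈⟨ ≈sym (ψ-hom p [ j ]) ⟩
      ψ (p ++ [ j ])             ∎)
    where
    open ≈-Reasoning
    x : Word
    x = ω* p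
    block∈ : Letters j (p′ ++ b ∷ q′)
    block∈ = subst (Letters j) eqⱼ (alt-letters (order j) (inj₁ refl) (inj₂ refl))
    p′∈ : Letters j p′
    p′∈ = Allₚ.++⁻ˡ p′ block∈
    b∈ : b ≡ rep j ⊎ b ≡ σ (rep j)
    b∈ = All.head (Allₚ.++⁻ʳ p′ block∈)
    -- The reflection belonging to the exchanged letter, computed inside its block: conjugation by
    -- `x` takes it to `rep i`.
    y : Word
    y = (p′ ++ [ b ]) ++ inv p′
    y∈ : Letters j y
    y∈ = Allₚ.++⁺ (Allₚ.++⁺ p′∈ (b∈ ∷ [])) (inv-letters p′∈)
    conjugate : rep i ∷ x ≈ x ++ y
    conjugate = ++-cancelʳ p′ _ _ (begin
      rep i ∷ x ++ p′                           ≈⟨ h ⟩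
      (x ++ p′) ++ [ b ]                        ≡⟨ ++-assoc x p′ [ b ] ⟩
      x ++ p′ ++ [ b ]                          ≡⟨ cong (x ++_) (sym (++-identityʳ _)) ⟩
      x ++ (p′ ++ [ b ]) ++ []                  ≈⟨ ++-congˡ x (++-congˡ (p′ ++ [ b ]) (≈sym (inverseˡ p′))) ⟩
      x ++ (p′ ++ [ b ]) ++ inv p′ ++ p′        ≡⟨ cong (x ++_) (sym (++-assoc (p′ ++ [ b ]) (inv p′) p′)) ⟩
      x ++ y ++ p′                              ≡⟨ sym (++-assoc x y p′) ⟩
      (x ++ y) ++ p′                            ∎)
    moved : ∃[ z ] (Letters j z × ω i ++ x ≈ x ++ z)
    moved = commute-past (y , y∈ , conjugate) (ω*-fixed p) (ω i) (alt-letters (order i) (inj₁ refl) (inj₂ refl))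
    z : Word
    z = proj₁ moved
    z∈ : Letters j z
    z∈ = proj₁ (proj₂ moved)
    past : ω i ++ x ≈ x ++ z
    past = proj₂ (proj₂ moved)
    z-fixed : map σ z ≈ z
    z-fixed = ++-cancelˡ x _ _ (begin
      x ++ map σ z               ≈⟨ ++-congʳ (map σ z) (≈sym (ω*-fixed p)) ⟩
      map σ x ++ map σ z         ≡⟨ sym (map-++ σ x z) ⟩
      map σ (x ++ z)             ≈⟨ map-σ-cong (≈sym past) ⟩
      map σ (ω i ++ x)           ≡⟨ map-++ σ (ω i) x ⟩
      map σ (ω i) ++ map σ x     ≈⟨ ++-cong (ω-fixed i) (ω*-fixed p) ⟩
      ω i ++ x                   ≈⟨ past ⟩
      x ++ z                     ∎)
    z≉[] : ¬ z ≈ []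
    z≉[] e = order≢0 i (trans (sym (length-alt (order i) _ _)) (ℕₚ.n≤0⇒n≡0 (ω-reduced i []
      (≈sym (++-cancelʳ x (ω i) [] (≈trans past (≈trans (++-congˡ x e) (≡⇒≈ (++-identityʳ x)))))))))

  -- If `rep i` were a descent of the remaining blocks, `folded-exchange` would contradict
  -- reducedness in W̃; otherwise neither letter of the orbit is a descent and lengths add.
  ω*-reduced : ∀ u → Reduced m̃ u → Reduced m (ω* u)
  ω*-reduced [] _ = reduced-[]
  ω*-reduced (i ∷ u) r with ω*-reduced u (W̃.reduced-tail r) | descent? (rep i) (ω* u)
  ... | ru | yes D = ⊥-elim (W̃.strip⇒¬reduced (W̃.exchange⇒strip (folded-exchange i u ru D)) r)
  ... | ru | no ¬D = alt-++-reduced ru ¬D (fixed-¬descent (ω*-fixed u) ¬D) (order i) (inj₁ (refl , refl)) (inj₁ ℕₚ.≤-refl)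

  -- Recursion on `v`. If the orbit of `rep i` consists of descents of `ψ u`, the block is removed
  -- on both sides and the rest of `ψ u` is `ψ (i ∷ u)`; otherwise the block is skipped.
  ψ-≼ : ∀ v u → ψ u ≼ ω* v → u W̃.≼ v
  ψ-≼ [] u (.[] , [] , e) = [] , [] , ψ-inj _ _ (≈trans ψ-[] e)
  ψ-≼ (i ∷ v) u h with descent? (rep i) (ψ u)
  ... | no ¬D with ψ-≼ v u (lift-up (ω i) (alt-letters (order i) ¬D (fixed-¬descent (ψ-fixed u) ¬D)) h)
  ...   | z , sub , e = z , i ∷ʳ sub , e
  ψ-≼ (i ∷ v) u h | yes D with dihedral D (fixed-descent (ψ-fixed u) D)
  ...   | _ , y , e , r with ψ-≼ v (i ∷ u) (≼-resp y≈ (lift-down (ω i) r (≼-resp e h)))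
    where
    y≈ : y ≈ ψ (i ∷ u)
    y≈ = ++-cancelˡ (ω i) _ _ (begin
      ω i ++ y              ≈⟨ ≈sym e ⟩
      ψ u                   ≈⟨ ψ-resp _ _ (≈sym (W̃.∷-square i u)) ⟩
      ψ (i ∷ i ∷ u)         ≈⟨ ψ-∷ i (i ∷ u) ⟩
      ω i ++ ψ (i ∷ u)      ∎)
      where open ≈-Reasoning
  ...     | z , sub , e′ = i ∷ z , refl ∷ sub , ≈trans (W̃.∷-cong i e′) (W̃.∷-square i u)

  ψ-monotone : ∀ {u v} → Bruhat m̃ u v → Bruhat m (ψ u) (ψ v)
  ψ-monotone {u} {v} (v′ , u′ , e , rv , sub , ru , f) =
    ω* v′ , ω* u′ , ≈trans (ω*≈ψ v′) (ψ-resp _ _ e) , ω*-reduced v′ rv , concatMap-⊆ ω sub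
    , ω*-reduced u′ ru , ≈trans (ω*≈ψ u′) (ψ-resp _ _ f)

  ψ-reflects : ∀ {u v} → Bruhat m (ψ u) (ψ v) → Bruhat m̃ u v
  -- The given reduced word `w` of `ψ v` need not be made of blocks; `≼-transfer` moves the subword
  -- to the reduced block word `ω* v̂`.
  ψ-reflects {u} {v} (w , x , e , rw , sub , rx , f) = result (W̃.≼-reduced (ψ-≼ v̂ u
      (≼-transfer (length w) w (ω* v̂) refl rw (ω*-reduced v̂ (W̃.normal-reduced v))
        (≈trans e (≈trans (ψ-resp _ _ (≈sym (W̃.normal-≈ v))) (≈sym (ω*≈ψ v̂)))) (x , sub , f))))
    where
    v̂ = W̃.normal v
    result : ∃[ z ] (z ⊆ v̂ × (Equiv m̃ z u × Reduced m̃ z)) → Bruhat m̃ u v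
    result (z , sub , e , r) = v̂ , z , W̃.normal-≈ v , W̃.normal-reduced v , sub , r , e

  -- outside of the fixed point subgroup the value is junk
  ψ⁻¹ : Word → List (Fin k)
  ψ⁻¹ w with φ w ≈? w
  ... | yes fixed = proj₁ (ψ-onto w fixed)
  ... | no _ = []

  ψ-ψ⁻¹ : ∀ w → Fixed m φ w → ψ (ψ⁻¹ w) ≈ w
  ψ-ψ⁻¹ w fixed with φ w ≈? w
  ... | yes fixed′ = proj₂ (ψ-onto w fixed′)
  ... | no ¬fixed = ⊥-elim (¬fixed fixed)

  bruhatIso : BruhatIso m φ m̃
  bruhatIso = record
    { F = ψ
    ; G = ψ⁻¹
    ; F-resp = ψ-resp
    ; F-fix = ψ-fix
    ; G-resp = λ w w′ fixed e → ψ-inj _ _ (≈trans (ψ-ψ⁻¹ w fixed)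
        (≈trans e (≈sym (ψ-ψ⁻¹ w′ (≈trans (resp _ _ (≈sym e)) (≈trans fixed e))))))
    ; GF = λ u → ψ-inj _ _ (ψ-ψ⁻¹ (ψ u) (ψ-fix u))
    ; FG = ψ-ψ⁻¹
    ; order = λ u v → mk⇔ ψ-monotone ψ-reflects
    }

theorem5p5 : ∀ (n : ℕ) (m : CoxMat n) → IsCoxeterMatrix m →
    (φ : List (Fin n) → List (Fin n)) → IsInvolutiveSAut m φ →
    (Wt : FoldedSystem m φ) → BruhatIso m φ (FoldedSystem.m̃ Wt)
theorem5p5 n m cox φ aut Wt = Folding.bruhatIso m cox φ aut Wt
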